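{- Let $X=\{0,1,\ldots,7\}$, $Y=\{a,b,c,d\}$, and let $v=yx_1x_2\ldots$ and $w=y'x_1'x_2'\ldots$ be elements of $Y\times X^\infty$. Let $G$ be the subgroup of the symmetric group $\mathrm{Sym}(X)$ generated by the permutations $(1357)(2460)$ and $(04)(13)(57)$ (a group isomorphic to the dihedral group of order $8$). Then the infinite graphs $\Gamma_v$ and $\Gamma_w$, regarded as unrooted graphs, are isomorphic if and only if there exists $\sigma\in G$ such that the infinite word $x_1'x_2'\ldots$ is cofinal with $\sigma(x_1x_2\ldots):=\sigma(x_1)\sigma(x_2)\ldots$.
   Context: Construction. Let $t_0=(0,0)$, $t_1=(1,0)$, $t_2=(2,0)$, $t_3=(2,1)$, $t_4=(2,2)$, $t_5=(1,2)$, $t_6=(0,2)$, $t_7=(0,1)$; these are the lower-left corners of the eight outer unit cells of the $3\times 3$ grid $[0,3]^2$ (the middle cell is omitted). The graph $\Gamma_1$ is the 4-cycle embedded as the unit square with vertices $a=(0,0)$, $b=(1,0)$, $c=(1,1)$, $d=(0,1)$ and its four sides as edges. For $n\ge1$, $\Gamma_{n+1}$ is the union of the eight translated copies $\Gamma_n+3^{n-1}t_k$, $k=0,\ldots,7$ (vertices with equal coordinates identified, edge sets united); adjacent copies share a common side and the middle cell is empty except for its boundary. For a finite word $yx_1\ldots x_{n-1}$ ($y\in Y$, $x_i\in X$) the corresponding vertex of $\Gamma_n$ is the point $p(y)+\sum_{i=1}^{n-1}3^{i-1}t_{x_i}$, where $p(a)=(0,0),p(b)=(1,0),p(c)=(1,1),p(d)=(0,1)$.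 For $w=yx_1x_2\ldots\in Y\times X^\infty$ let $w_n=yx_1\ldots x_{n-1}$ and let $\Gamma^n_w$ be $\Gamma_n$ rooted at the vertex $w_n$ (equivalently, $\Gamma^{n+1}_w$ is built from 8 copies of $\Gamma^n_w$ in positions $0,\ldots,7$ with root the root of the copy in position $x_n$). The infinite rooted graph $\Gamma_w$ is the limit of $\Gamma^n_w$ in the sense that for each $r>0$ the ball of radius $r$ about the root of $\Gamma_w$ is isomorphic to the ball of radius $r$ about $w_n$ in $\Gamma^n_w$ for all large $n$ (concretely, the increasing union of the $\Gamma^n_w$ translated so that their roots are at the origin). Two infinite words over $X$ are cofinal if they differ in only finitely many positions. -}

module Defs where

open import Data.Nat using (ℕ; zero; suc; _^_; _*_; _≤_)
open import Data.Integer as ℤ using (ℤ; +_)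
open import Data.Fin using (Fin; #_)
open import Data.Vec using (Vec; []; _∷_; lookup)
open import Data.Product using (Σ; _×_; _,_; proj₁; proj₂)
open import Data.Sum using (_⊎_)
open import Data.Bool using (Bool; true; false)
open import Data.List using (List; []; _∷_)
open import Function using (_∘_; id)
open import Function.Bundles using (_↔_; _⇔_; Inverse)
open import Relation.Binary.PropositionalEquality using (_≡_)

Pt : Set
Pt = ℤ × ℤ

_⊕_ : Pt → Pt → Pt
(a , b) ⊕ (c , d) = (a ℤ.+ c , b ℤ.+ d)

_⊖_ : Pt → Pt → Pt
(a , b) ⊖ (c , d) = (a ℤ.- c , b ℤ.- d)

X : Set
X = Fin 8

data Y : Set where
  a b c d : Y

pos : Y → Pt
pos a = (+ 0 , + 0)
pos b = (+ 1 , + 0)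
pos c = (+ 1 , + 1)
pos d = (+ 0 , + 1)

-- t_k, the lower-left corners of the eight outer cells of the 3×3 grid
tvec : Vec (ℕ × ℕ) 8
tvec = (0 , 0) ∷ (1 , 0) ∷ (2 , 0) ∷ (2 , 1) ∷ (2 , 2) ∷ (1 , 2) ∷ (0 , 2) ∷ (0 , 1) ∷ []

shift : ℕ → X → Pt
shift k j = (+ (3 ^ k * proj₁ (lookup tvec j)) , + (3 ^ k * proj₂ (lookup tvec j)))

next : Y → Y
next a = b
next b = c
next c = d
next d = a

UnitSide : Pt → Pt → Set
UnitSide p q = Σ Y λ y → (p ≡ pos y × q ≡ pos (next y)) ⊎ (q ≡ pos y × p ≡ pos (next y))

-- Level k here is Γ_{k+1} (side length 3^k); Γ_{k+2} is the union of the
-- copies Γ_{k+1} + 3^k t_j, j = 0..7.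
Adj : ℕ → Pt → Pt → Set
Adj zero p q = UnitSide p q
Adj (suc k) p q = Σ X λ j → Adj k (p ⊖ shift k j) (q ⊖ shift k j)

Vert : ℕ → Pt → Set
Vert zero p = Σ Y λ y → p ≡ pos y
Vert (suc k) p = Σ X λ j → Vert k (p ⊖ shift k j)

-- Infinite words over X: x i is the letter x_{i+1}.
Word : Set
Word = ℕ → X

-- Position of the root w_{k+1} = y x_1 … x_k in Γ_{k+1}:
-- p(y) + Σ_{i<k} 3^i t_{x i}.
root : Y → Word → ℕ → Pt
root y x zero = pos y
root y x (suc k) = root y x k ⊕ shift k (x k)

-- The infinite graph Γ_w (w = y x), translated so that its root is at the
-- origin: the increasing union of the Γ^n_w translated by −(root).
VInf : Y → Word → Pt → Set
VInf y x p = Σ ℕ λ k → Vert k (p ⊕ root y x k)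

AdjInf : Y → Word → Pt → Pt → Set
AdjInf y x p q = Σ ℕ λ k → Adj k (p ⊕ root y x k) (q ⊕ root y x k)

-- Vertex type of Γ_w (membership proof irrelevant, so a vertex is just a point).
record VΓ (y : Y) (x : Word) : Set where
  constructor vtx
  field
    pt : Pt
    .isV : VInf y x pt
open VΓ public

GraphIso : Y → Word → Y → Word → Set
GraphIso y x y' x' =
  Σ (VΓ y x ↔ VΓ y' x') λ f →
    ∀ (u v : VΓ y x) →
      AdjInf y x (pt u) (pt v) ⇔ AdjInf y' x' (pt (Inverse.to f u)) (pt (Inverse.to f v))

-- Generators of G ≤ Sym(X):  r = (1357)(2460),  s = (04)(13)(57)
genR : X → X
genR = lookup (# 2 ∷ # 3 ∷ # 4 ∷ # 5 ∷ # 6 ∷ # 7 ∷ # 0 ∷ # 1 ∷ [])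

genS : X → X
genS = lookup (# 4 ∷ # 3 ∷ # 2 ∷ # 1 ∷ # 0 ∷ # 7 ∷ # 6 ∷ # 5 ∷ [])

gen : Bool → X → X
gen true = genR
gen false = genS

evalWord : List Bool → X → X
evalWord [] = id
evalWord (g ∷ gs) = gen g ∘ evalWord gs

-- σ ∈ G: σ is (pointwise) a product of generators.  Since G is finite, the
-- submonoid generated by r, s equals the subgroup generated by them.
InG : (X → X) → Set
InG σ = Σ (List Bool) λ ws → ∀ i → σ i ≡ evalWord ws i

Cofinal : Word → Word → Set
Cofinal x x' = Σ ℕ λ N → ∀ i → N ≤ i → x i ≡ x' i

{-# OPTIONS --safe #-}
module Submission where

-- An isomorphism maps 4-cycles, which are exactly the unit squares, to
-- 4-cycles, and adjacent squares to adjacent squares; hence it is the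
-- restriction of a symmetry g of ℤ². A hole of side 3 ^ m (m ≥ 1) is
-- recognised among all empty boxes of that side as one whose four neighbours
-- are filled, and it is the centre of a box of the next level. (Holes of side
-- 1 are invisible; the grid of level 1 is recovered from the vertices with a
-- missing neighbour.) So the symmetry takes boxes of every level to boxes of
-- that level, and turns the position of a box in its parent by g. The images
-- of the boxes of one root are eventually the boxes of the other root, and
-- from then on the letters correspond under g. Conversely a symmetry g that
-- matches the letters from level N on matches the boxes of level N, and then,
-- one level down at a time, the unit cells.

open import Defs renaming (_⊕_ to infixl 6 _⊕_; _⊖_ to infixl 6 _⊖_)
open import Algebra.Construct.DirectProduct using (commutativeRing)
import Algebra.Solver.Ring.AlmostCommutativeRing as ACR
import Algebra.Solver.Ring.Simple as RingSolver
open import Data.Bool using (Bool; true; false; not)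
open import Data.Empty using (⊥; ⊥-elim)
open import Data.Fin using (Fin; zero; suc; #_; toℕ)
open import Data.Fin.Patterns using (0F; 1F; 2F; 3F; 4F; 5F; 6F; 7F)
import Data.Fin as Fin
import Data.Fin.Properties as Fin
open import Data.Integer as ℤ using (ℤ; +_; ∣_∣)
import Data.Integer.DivMod as ℤ
import Data.Integer.Properties as ℤ
open import Data.Integer.Tactic.RingSolver using (solve-∀)
open import Data.Integer.Solver using (module +-*-Solver)
open import Data.List using (List; []; _∷_)
open import Data.Nat as ℕ using (ℕ; zero; suc; _^_; z≤n; s≤s)
import Data.Nat.Properties as ℕ
open import Data.Product using (Σ; _×_; _,_; proj₁; proj₂)
open import Data.Product.Properties using (≡-dec)
open import Data.Product.Relation.Binary.Pointwise.NonDependent using (×-decidable; ≡×≡⇒≡)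
open import Data.Sum using (_⊎_; inj₁; inj₂)
open import Data.Vec using (lookup; _∷_; [])
open import Function using (_∘_; case_of_)
open import Function.Bundles using (_⇔_; mk⇔; Equivalence; Inverse; mk↔ₛ′)
open import Relation.Binary.PropositionalEquality
  using (_≡_; _≢_; refl; sym; trans; cong; cong₂; subst; subst₂; module ≡-Reasoning)
open import Relation.Nullary using (¬_; Dec; yes; no)
open import Relation.Nullary.Decidable using (toWitness; ¬?; _→-dec_; _×-dec_; _⊎-dec_)

-- The lattice ℤ² and the symmetries of a square box

-- From side 3 on a box has lattice points strictly inside, and these are vertices only if the box
-- is filled; a hole of side 1 has just its four corners, all of them present. Boxes of level `m`
-- are named by integer points relative to the root's own box `𝟎`, so the letters enter only as
-- base-3 digits relating a box to its parent. In these coordinates a symmetry acts at each level by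
-- one fixed linear part and a translation that depends on the level, and cofinality amounts to this
-- translation being eventually `𝟎`. It reaches `𝟎` because every filled box shares an ancestor with
-- the root, and stays `𝟎` because base-3 digits are unique. In the converse direction it is `𝟎` at
-- level `N` and is recomputed on the way down.

flip : Bool → ℤ → ℤ → ℤ
flip false n u = u
flip true n u = n ℤ.- u

flip-+ : ∀ f m n u v → flip f (m ℤ.+ n) (u ℤ.+ v) ≡ flip f m u ℤ.+ flip f n v
flip-+ false m n u v = refl
flip-+ true = solve 4 (λ m n u v → (m :+ n) :- (u :+ v) := (m :- u) :+ (n :- v)) refl
  where open +-*-Solver

flip-* : ∀ f k n u → flip f (k ℤ.* n) (k ℤ.* u) ≡ k ℤ.* flip f n u
flip-* false k n u = refl
flip-* true = solve 3 (λ k n u → k :* n :- k :* u := k :* (n :- u)) refl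
  where open +-*-Solver

flip-flip : ∀ f n u → flip f n (flip f n u) ≡ u
flip-flip false n u = refl
flip-flip true = solve 2 (λ n u → n :- (n :- u) := u) refl
  where open +-*-Solver

-- The ring solver applies to points because ℤ × ℤ is a commutative ring
-- (with the componentwise product _⊗_); the scalar n enters as dg n.
module PtSolver = RingSolver
  (ACR.fromCommutativeRing (commutativeRing ℤ.+-*-commutativeRing ℤ.+-*-commutativeRing))
  (×-decidable ℤ._≟_ ℤ._≟_)
open PtSolver using (solve; _:=_; _:+_; _:*_; _:-_; con)

infixl 7 _⊗_

_⊗_ : Pt → Pt → Pt
(u , v) ⊗ (u′ , v′) = (u ℤ.* u′ , v ℤ.* v′)

dg : ℤ → Pt
dg n = (n , n)

𝟎 𝟏 𝟛 : Pt
𝟎 = dg (+ 0)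
𝟏 = dg (+ 1)
𝟛 = dg (+ 3)

-- Reduces a linear consequence of L′ ≡ R′ to a ring identity.
linear : ∀ {L R L′ R′} → L′ ≡ R′ → L ⊕ R′ ≡ R ⊕ L′ → L ≡ R
linear {L} {R} {L′} refl e = begin
  L              ≡⟨ ≡×≡⇒≡ (solve 2 (λ l m → l := l :+ m :- m) (refl , refl) L L′) ⟩
  L ⊕ L′ ⊖ L′    ≡⟨ cong (_⊖ L′) e ⟩
  R ⊕ L′ ⊖ L′    ≡⟨ ≡×≡⇒≡ (solve 2 (λ l m → l :+ m :- m := l) (refl , refl) R L′) ⟩
  R              ∎
  where open ≡-Reasoning

⊕-cancelˡ : ∀ p {q r} → p ⊕ q ≡ p ⊕ r → q ≡ r
⊕-cancelˡ p {q} {r} e = linear e (≡×≡⇒≡ (solve 3 (λ p q r → q :+ (p :+ r) := r :+ (p :+ q)) (refl , refl) p q r))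

side : ℕ → ℤ
side zero = + 1
side (suc k) = + 3 ℤ.* side k

side≡ : ∀ k → side k ≡ + (3 ^ k)
side≡ zero = refl
side≡ (suc k) = trans (cong (+ 3 ℤ.*_) (side≡ k)) (sym (ℤ.pos-* 3 (3 ^ k)))

𝕤 : ℕ → Pt
𝕤 k = dg (side k)

t : X → Pt
t j = (+ proj₁ (lookup tvec j) , + proj₂ (lookup tvec j))

shift≡ : ∀ k j → shift k j ≡ 𝕤 k ⊗ t j
shift≡ k j rewrite side≡ k = cong₂ _,_ (ℤ.pos-* (3 ^ k) _) (ℤ.pos-* (3 ^ k) _)

offset : Word → ℕ → Pt
offset x zero = 𝟎
offset x (suc k) = offset x k ⊕ 𝕤 k ⊗ t (x k)

root≡ : ∀ y x k → root y x k ≡ pos y ⊕ offset x k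
root≡ y x zero = ≡×≡⇒≡ (solve 1 (λ p → p := p :+ con 𝟎) (refl , refl) (pos y))
root≡ y x (suc k) = trans (cong₂ _⊕_ (root≡ y x k) (shift≡ k (x k)))
  (≡×≡⇒≡ (solve 3 (λ p q r → p :+ q :+ r := p :+ (q :+ r)) (refl , refl) (pos y) (offset x k) (𝕤 k ⊗ t (x k))))

-- The symmetry (swap , flip₁ , flip₂) of a square: an optional exchange of
-- the coordinates followed by optional reflections u ↦ n − u.
D4 : Set
D4 = Bool × Bool × Bool

-- The symmetry g of the box [0,n]²; for n = 0 it is the linear part of g.
T : D4 → ℤ → Pt → Pt
T (false , f₁ , f₂) n (u , v) = (flip f₁ n u , flip f₂ n v)
T (true , f₁ , f₂) n (u , v) = (flip f₁ n v , flip f₂ n u)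

flip-not : ∀ f n u → flip (not f) n u ≡ flip true n (flip f n u)
flip-not false n u = refl
flip-not true n u = sym (flip-flip true n u)

-- Sizes add along with coordinates, so one `g` acts on every scale of a base-3 expansion:
-- displacements have size 0, corners of a unit cell size 1, digits size 2, points of a level-`m`
-- box size `side m`.
T-+ : ∀ g m n p q → T g (m ℤ.+ n) (p ⊕ q) ≡ T g m p ⊕ T g n q
T-+ (false , f₁ , f₂) m n (u , v) (u′ , v′) = cong₂ _,_ (flip-+ f₁ m n u u′) (flip-+ f₂ m n v v′)
T-+ (true , f₁ , f₂) m n (u , v) (u′ , v′) = cong₂ _,_ (flip-+ f₁ m n v v′) (flip-+ f₂ m n u u′)

T-* : ∀ g k n p → T g (k ℤ.* n) (dg k ⊗ p) ≡ dg k ⊗ T g n p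
T-* (false , f₁ , f₂) k n (u , v) = cong₂ _,_ (flip-* f₁ k n u) (flip-* f₂ k n v)
T-* (true , f₁ , f₂) k n (u , v) = cong₂ _,_ (flip-* f₁ k n v) (flip-* f₂ k n u)

T-translate : ∀ g n p q → T g n (p ⊕ q) ≡ T g n p ⊕ T g (+ 0) q
T-translate g n p q = trans (cong (λ m → T g m (p ⊕ q)) (sym (ℤ.+-identityʳ n))) (T-+ g n (+ 0) p q)

T-scale : ∀ g k p → T g (+ 0) (dg k ⊗ p) ≡ dg k ⊗ T g (+ 0) p
T-scale g k p = trans (cong (λ m → T g m (dg k ⊗ p)) (sym (ℤ.*-zeroʳ k))) (T-* g k (+ 0) p)

T-𝟎 : ∀ g → T g (+ 0) 𝟎 ≡ 𝟎
T-𝟎 (false , false , false) = refl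
T-𝟎 (false , false , true) = refl
T-𝟎 (false , true , false) = refl
T-𝟎 (false , true , true) = refl
T-𝟎 (true , false , false) = refl
T-𝟎 (true , false , true) = refl
T-𝟎 (true , true , false) = refl
T-𝟎 (true , true , true) = refl

inv : D4 → D4
inv (false , f₁ , f₂) = (false , f₁ , f₂)
inv (true , f₁ , f₂) = (true , f₂ , f₁)

T-invˡ : ∀ g n p → T (inv g) n (T g n p) ≡ p
T-invˡ (false , f₁ , f₂) n (u , v) = cong₂ _,_ (flip-flip f₁ n u) (flip-flip f₂ n v)
T-invˡ (true , f₁ , f₂) n (u , v) = cong₂ _,_ (flip-flip f₂ n u) (flip-flip f₁ n v)

T-invʳ : ∀ g n p → T g n (T (inv g) n p) ≡ p
T-invʳ (false , f₁ , f₂) n (u , v) = cong₂ _,_ (flip-flip f₁ n u) (flip-flip f₂ n v)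
T-invʳ (true , f₁ , f₂) n (u , v) = cong₂ _,_ (flip-flip f₁ n u) (flip-flip f₂ n v)

-- Composition on the left with the quarter turn `(u , v) ↦ (n − v , u)` and with the reflection in
-- the antidiagonal, which for `n = 2` induce `genR` and `genS` on the eight positions.
rotate reflect : D4 → D4
rotate (s , f₁ , f₂) = (not s , not f₂ , f₁)
reflect (s , f₁ , f₂) = (not s , not f₂ , not f₁)

T-rotate : ∀ g n p → T (rotate g) n p ≡ T (true , true , false) n (T g n p)
T-rotate (false , f₁ , false) n (u , v) = refl
T-rotate (false , f₁ , true) n (u , v) = cong (_, _) (sym (flip-flip true n v))
T-rotate (true , f₁ , false) n (u , v) = refl
T-rotate (true , f₁ , true) n (u , v) = cong (_, _) (sym (flip-flip true n u))

T-reflect : ∀ g n p → T (reflect g) n p ≡ T (true , true , true) n (T g n p)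
T-reflect (false , f₁ , f₂) n (u , v) = cong₂ _,_ (flip-not f₂ n v) (flip-not f₁ n u)
T-reflect (true , f₁ , f₂) n (u , v) = cong₂ _,_ (flip-not f₂ n u) (flip-not f₁ n v)

symmetry : List Bool → D4
symmetry [] = (false , false , false)
symmetry (true ∷ ws) = rotate (symmetry ws)
symmetry (false ∷ ws) = reflect (symmetry ws)

t-genR : ∀ j → t (genR j) ≡ T (true , true , false) (+ 2) (t j)
t-genR = toWitness {a? = Fin.all? λ j → ≡-dec ℤ._≟_ ℤ._≟_ (t (genR j)) _} _

t-genS : ∀ j → t (genS j) ≡ T (true , true , true) (+ 2) (t j)
t-genS = toWitness {a? = Fin.all? λ j → ≡-dec ℤ._≟_ ℤ._≟_ (t (genS j)) _} _

t-evalWord : ∀ ws j → t (evalWord ws j) ≡ T (symmetry ws) (+ 2) (t j)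
t-evalWord [] j = refl
t-evalWord (true ∷ ws) j = begin
  t (genR (evalWord ws j))                                   ≡⟨ t-genR (evalWord ws j) ⟩
  T (true , true , false) (+ 2) (t (evalWord ws j))          ≡⟨ cong (T (true , true , false) (+ 2)) (t-evalWord ws j) ⟩
  T (true , true , false) (+ 2) (T (symmetry ws) (+ 2) (t j)) ≡⟨ T-rotate (symmetry ws) (+ 2) (t j) ⟨
  T (rotate (symmetry ws)) (+ 2) (t j)                       ∎
  where open ≡-Reasoning
t-evalWord (false ∷ ws) j = begin
  t (genS (evalWord ws j))                                   ≡⟨ t-genS (evalWord ws j) ⟩
  T (true , true , true) (+ 2) (t (evalWord ws j))           ≡⟨ cong (T (true , true , true) (+ 2)) (t-evalWord ws j) ⟩
  T (true , true , true) (+ 2) (T (symmetry ws) (+ 2) (t j)) ≡⟨ T-reflect (symmetry ws) (+ 2) (t j) ⟨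
  T (reflect (symmetry ws)) (+ 2) (t j)                      ∎
  where open ≡-Reasoning

-- The normal forms r^k and s r^k of the dihedral group, with s applied last; hence every symmetry
-- of the square induces an element of G.
word : D4 → List Bool
word (false , false , false) = []
word (false , false , true) = false ∷ true ∷ true ∷ true ∷ []
word (false , true , false) = false ∷ true ∷ []
word (false , true , true) = true ∷ true ∷ []
word (true , false , false) = false ∷ true ∷ true ∷ []
word (true , false , true) = true ∷ true ∷ true ∷ []
word (true , true , false) = true ∷ []
word (true , true , true) = false ∷ []

symmetry-word : ∀ g → symmetry (word g) ≡ g
symmetry-word (false , false , false) = refl
symmetry-word (false , false , true) = refl
symmetry-word (false , true , false) = refl
symmetry-word (false , true , true) = refl
symmetry-word (true , false , false) = refl
symmetry-word (true , false , true) = refl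
symmetry-word (true , true , false) = refl
symmetry-word (true , true , true) = refl

perm : D4 → X → X
perm g = evalWord (word g)

t-perm : ∀ g j → t (perm g j) ≡ T g (+ 2) (t j)
t-perm g j = trans (t-evalWord (word g) j) (cong (λ h → T h (+ 2) (t j)) (symmetry-word g))

-- Filled boxes

-- Fill x m K: in the grid of boxes of side 3 ^ m having the level-m box of the
-- root as its box 𝟎, the box K is a copy of the level-m graph inside Γ_x
-- (rather than part of a hole or outside the graph).
data Fill (x : Word) : ℕ → Pt → Set where
  here  : ∀ {m} → Fill x m 𝟎
  there : ∀ {m K} J j → K ⊕ t (x m) ≡ 𝟛 ⊗ J ⊕ t j → Fill x (suc m) J → Fill x m K

parent : ∀ {x m K} → Fill x m K →
  Σ Pt λ J → Σ X λ j → K ⊕ t (x m) ≡ 𝟛 ⊗ J ⊕ t j × Fill x (suc m) J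
parent {x} {m} here = 𝟎 , x m , refl , here
parent (there J j e f) = J , j , e , f

-- Cell k r: the unit cell with lower-left corner r is filled in the graph of level k.
data Cell : ℕ → Pt → Set where
  unit : Cell zero 𝟎
  copy : ∀ {k r} → Cell k r → (j : X) → Cell (suc k) (r ⊕ 𝕤 k ⊗ t j)

subcell : ∀ {x m K r} → Fill x m K → Cell m r → Fill x zero (𝕤 m ⊗ K ⊕ r ⊖ offset x m)
subcell {x} {K = K} f unit =
  subst (Fill x zero) (≡×≡⇒≡ (solve 1 (λ K → K := con (𝕤 0) :* K :+ con 𝟎 :- con 𝟎) (refl , refl) K)) f
subcell {x} {suc m} {K} f (copy {r = r} s j) =
  subst (Fill x zero) eq (subcell (there K j (≡×≡⇒≡ (solve 2 (λ u v → u :- v :+ v := u) (refl , refl) (𝟛 ⊗ K ⊕ t j) (t (x m)))) f) s)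
  where
  eq : 𝕤 m ⊗ (𝟛 ⊗ K ⊕ t j ⊖ t (x m)) ⊕ r ⊖ offset x m
     ≡ 𝕤 (suc m) ⊗ K ⊕ (r ⊕ 𝕤 m ⊗ t j) ⊖ (offset x m ⊕ 𝕤 m ⊗ t (x m))
  eq = ≡×≡⇒≡ (solve 6 (λ s K r o u v →
    s :* (con 𝟛 :* K :+ u :- v) :+ r :- o := con 𝟛 :* s :* K :+ (r :+ s :* u) :- (o :+ s :* v))
    (refl , refl) (𝕤 m) K r (offset x m) (t j) (t (x m)))

ancestor : ∀ {x p} → Fill x zero p → ∀ m →
  Σ Pt λ K → Σ Pt λ r → Fill x m K × Cell m r × p ⊕ offset x m ≡ 𝕤 m ⊗ K ⊕ r
ancestor {p = p} f zero = p , 𝟎 , f , unit ,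
  ≡×≡⇒≡ (solve 1 (λ p → p :+ con 𝟎 := con (𝕤 0) :* p :+ con 𝟎) (refl , refl) p)
ancestor {x} {p} f (suc m) with ancestor f m
... | K , r , f′ , s , e with parent f′
... | J , j , e′ , f″ = J , r ⊕ 𝕤 m ⊗ t j , f″ , copy s j , linear e (linear (cong (𝕤 m ⊗_) e′) eq)
  where
  eq : p ⊕ (offset x m ⊕ 𝕤 m ⊗ t (x m)) ⊕ (𝕤 m ⊗ K ⊕ r) ⊕ 𝕤 m ⊗ (𝟛 ⊗ J ⊕ t j)
     ≡ 𝕤 (suc m) ⊗ J ⊕ (r ⊕ 𝕤 m ⊗ t j) ⊕ (p ⊕ offset x m) ⊕ 𝕤 m ⊗ (K ⊕ t (x m))
  eq = ≡×≡⇒≡ (solve 8 (λ p o s v K r J u →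
    p :+ (o :+ s :* v) :+ (s :* K :+ r) :+ s :* (con 𝟛 :* J :+ u)
    := con 𝟛 :* s :* J :+ (r :+ s :* u) :+ (p :+ o) :+ s :* (K :+ v))
    (refl , refl) p (offset x m) (𝕤 m) (t (x m)) K r J (t j))

-- Each `there` is matched by a `copy`, and the finite chain of ancestors ends at the root's own box
-- of some level. This is how `Fill` meets the increasing union of finite graphs.
enclosing : ∀ {x m K r} → Fill x m K → Cell m r →
  Σ ℕ λ k → Cell k (𝕤 m ⊗ K ⊕ r ⊖ offset x m ⊕ offset x k)
enclosing {x} {m} {r = r} here s = m , subst (Cell m)
  (≡×≡⇒≡ (solve 3 (λ s r o → r := s :* con 𝟎 :+ r :- o :+ o) (refl , refl) (𝕤 m) r (offset x m))) s
enclosing {x} {m} {K} {r} (there J j e f) s with enclosing f (copy s j)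
... | k , s′ = k , subst (Cell k) (linear (cong (𝕤 m ⊗_) (sym e)) eq) s′
  where
  eq : 𝕤 (suc m) ⊗ J ⊕ (r ⊕ 𝕤 m ⊗ t j) ⊖ (offset x m ⊕ 𝕤 m ⊗ t (x m)) ⊕ offset x k ⊕ 𝕤 m ⊗ (K ⊕ t (x m))
     ≡ 𝕤 m ⊗ K ⊕ r ⊖ offset x m ⊕ offset x k ⊕ 𝕤 m ⊗ (𝟛 ⊗ J ⊕ t j)
  eq = ≡×≡⇒≡ (solve 8 (λ s K r o u v J o′ →
    con 𝟛 :* s :* J :+ (r :+ s :* u) :- (o :+ s :* v) :+ o′ :+ s :* (K :+ v)
    := s :* K :+ r :- o :+ o′ :+ s :* (con 𝟛 :* J :+ u))
    (refl , refl) (𝕤 m) K r (offset x m) (t j) (t (x m)) J (offset x k))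

-- The vertices and edges of Γ_w in coordinates with the lower-left corner of
-- the unit cell of the root at the origin; they do not depend on y.
data Side (y : Y) (o p q : Pt) : Set where
  ccw : p ≡ o ⊕ pos y → q ≡ o ⊕ pos (next y) → Side y o p q
  cw  : q ≡ o ⊕ pos y → p ≡ o ⊕ pos (next y) → Side y o p q

data V (x : Word) (p : Pt) : Set where
  corner : ∀ o → Fill x zero o → ∀ y → p ≡ o ⊕ pos y → V x p

data E (x : Word) (p q : Pt) : Set where
  edge : ∀ o → Fill x zero o → ∀ y → Side y o p q → E x p q

Side-map : ∀ {y o o′ p p′ q q′} → (∀ u → p ≡ o ⊕ u → p′ ≡ o′ ⊕ u) → (∀ u → q ≡ o ⊕ u → q′ ≡ o′ ⊕ u) →
  Side y o p q → Side y o′ p′ q′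
Side-map f g (ccw e e′) = ccw (f _ e) (g _ e′)
Side-map f g (cw e e′) = cw (g _ e) (f _ e′)

E-sym : ∀ {x p q} → E x p q → E x q p
E-sym (edge o f y (ccw e e′)) = edge o f y (cw e e′)
E-sym (edge o f y (cw e e′)) = edge o f y (ccw e e′)

E⇒V : ∀ {x p q} → E x p q → V x p
E⇒V (edge o f y (ccw e _)) = corner o f y e
E⇒V (edge o f y (cw _ e)) = corner o f (next y) e

V⇒E : ∀ {x p} → V x p → Σ Pt (E x p)
V⇒E (corner o f y e) = o ⊕ pos (next y) , edge o f y (ccw e refl)

unshift : ∀ k j p r z → p ⊖ shift k j ≡ r ⊕ z → p ≡ r ⊕ 𝕤 k ⊗ t j ⊕ z
unshift k j p r z e = linear e (linear (shift≡ k j) (≡×≡⇒≡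
  (solve 5 (λ p r z u v → p :+ (r :+ z) :+ u := r :+ u :+ z :+ (p :- v) :+ v) (refl , refl) p r z (𝕤 k ⊗ t j) (shift k j))))

reshift : ∀ k j p r z → p ≡ r ⊕ 𝕤 k ⊗ t j ⊕ z → p ⊖ shift k j ≡ r ⊕ z
reshift k j p r z e = linear e (linear (sym (shift≡ k j)) (≡×≡⇒≡
  (solve 5 (λ p r z u v → p :- v :+ (r :+ u :+ z) :+ v := r :+ z :+ p :+ u) (refl , refl) p r z (𝕤 k ⊗ t j) (shift k j))))

𝟎⊕ : ∀ p → 𝟎 ⊕ p ≡ p
𝟎⊕ p = ≡×≡⇒≡ (solve 1 (λ p → con 𝟎 :+ p := p) (refl , refl) p)

Vert⇒Cell : ∀ k {p} → Vert k p → Σ Pt λ r → Cell k r × Σ Y λ y → p ≡ r ⊕ pos y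
Vert⇒Cell zero (y , e) = 𝟎 , unit , y , trans e (sym (𝟎⊕ (pos y)))
Vert⇒Cell (suc k) {p} (j , v) with Vert⇒Cell k v
... | r , s , y , e = r ⊕ 𝕤 k ⊗ t j , copy s j , y , unshift k j p r (pos y) e

Cell⇒Vert : ∀ {k p r} y → Cell k r → p ≡ r ⊕ pos y → Vert k p
Cell⇒Vert y unit e = y , trans e (𝟎⊕ (pos y))
Cell⇒Vert {suc k} {p} y (copy {r = r} s j) e = j , Cell⇒Vert y s (reshift k j p r (pos y) e)

Adj⇒Cell : ∀ k p q → Adj k p q → Σ Pt λ r → Cell k r × Σ Y λ y → Side y r p q
Adj⇒Cell zero p q (y , inj₁ (e , e′)) = 𝟎 , unit , y , ccw (trans e (sym (𝟎⊕ _))) (trans e′ (sym (𝟎⊕ _)))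
Adj⇒Cell zero p q (y , inj₂ (e , e′)) = 𝟎 , unit , y , cw (trans e (sym (𝟎⊕ _))) (trans e′ (sym (𝟎⊕ _)))
Adj⇒Cell (suc k) p q (j , v) with Adj⇒Cell k (p ⊖ shift k j) (q ⊖ shift k j) v
... | r , s , y , e = r ⊕ 𝕤 k ⊗ t j , copy s j , y , Side-map (unshift k j p r) (unshift k j q r) e

Cell⇒Adj : ∀ {k p q r y} → Cell k r → Side y r p q → Adj k p q
Cell⇒Adj {y = y} unit (ccw e e′) = y , inj₁ (trans e (𝟎⊕ _) , trans e′ (𝟎⊕ _))
Cell⇒Adj {y = y} unit (cw e e′) = y , inj₂ (trans e (𝟎⊕ _) , trans e′ (𝟎⊕ _))
Cell⇒Adj {suc k} {p} {q} (copy {r = r} s j) e = j , Cell⇒Adj s (Side-map (reshift k j p r) (reshift k j q r) e)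

local : ∀ y x k p r u → p ⊕ root y x k ≡ r ⊕ u → p ⊕ pos y ≡ 𝕤 k ⊗ 𝟎 ⊕ r ⊖ offset x k ⊕ u
local y x k p r u e = linear e (linear (sym (root≡ y x k)) (≡×≡⇒≡
  (solve 7 (λ p z r u o ρ s → p :+ z :+ (r :+ u) :+ ρ := s :* con 𝟎 :+ r :- o :+ u :+ (p :+ ρ) :+ (z :+ o))
    (refl , refl) p (pos y) r u (offset x k) (root y x k) (𝕤 k))))

global : ∀ y x k p o u → p ⊕ pos y ≡ o ⊕ u → p ⊕ root y x k ≡ 𝕤 0 ⊗ o ⊕ 𝟎 ⊖ 𝟎 ⊕ offset x k ⊕ u
global y x k p o u e = linear e (linear (root≡ y x k) (≡×≡⇒≡
  (solve 6 (λ p z o u w ρ → p :+ ρ :+ (o :+ u) :+ (z :+ w) := con (𝕤 0) :* o :+ con 𝟎 :- con 𝟎 :+ w :+ u :+ (p :+ z) :+ ρ)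
    (refl , refl) p (pos y) o u (offset x k) (root y x k))))

VInf⇒V : ∀ {y x p} → VInf y x p → V x (p ⊕ pos y)
VInf⇒V {y} {x} {p} (k , v) with Vert⇒Cell k v
... | r , s , y′ , e = corner _ (subcell here s) y′ (local y x k p r (pos y′) e)

V⇒VInf : ∀ {y x p} → V x (p ⊕ pos y) → VInf y x p
V⇒VInf {y} {x} {p} (corner o f y′ e) with enclosing f unit
... | k , s = k , Cell⇒Vert y′ s (global y x k p o (pos y′) e)

AdjInf⇒E : ∀ {y x p q} → AdjInf y x p q → E x (p ⊕ pos y) (q ⊕ pos y)
AdjInf⇒E {y} {x} {p} {q} (k , v) with Adj⇒Cell k (p ⊕ root y x k) (q ⊕ root y x k) v
... | r , s , y′ , e = edge _ (subcell here s) y′ (Side-map (local y x k p r) (local y x k q r) e)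

E⇒AdjInf : ∀ {y x p q} → E x (p ⊕ pos y) (q ⊕ pos y) → AdjInf y x p q
E⇒AdjInf {y} {x} {p} {q} (edge o f y′ e) with enclosing f unit
... | k , s = k , Cell⇒Adj s (Side-map (global y x k p o) (global y x k q o) e)

-- From a symmetry of the words to an isomorphism

T-parent : ∀ g K J I I₁ u v u′ → K ⊕ u ≡ 𝟛 ⊗ J ⊕ v → I ⊕ u′ ≡ 𝟛 ⊗ I₁ ⊕ T g (+ 2) u →
  (T g (+ 0) K ⊕ I) ⊕ u′ ≡ 𝟛 ⊗ (T g (+ 0) J ⊕ I₁) ⊕ T g (+ 2) v
T-parent g K J I I₁ u v u′ e e′ = linear e′ (linear e″ (≡×≡⇒≡
  (solve 7 (λ k j i i₁ u v w → k :+ i :+ w :+ (con 𝟛 :* i₁ :+ u) :+ (con 𝟛 :* j :+ v)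
                             := con 𝟛 :* (j :+ i₁) :+ v :+ (i :+ w) :+ (k :+ u))
    (refl , refl) (T g (+ 0) K) (T g (+ 0) J) I I₁ (T g (+ 2) u) (T g (+ 2) v) u′)))
  where
  open ≡-Reasoning
  e″ : T g (+ 0) K ⊕ T g (+ 2) u ≡ 𝟛 ⊗ T g (+ 0) J ⊕ T g (+ 2) v
  e″ = begin
    T g (+ 0) K ⊕ T g (+ 2) u                ≡⟨ T-+ g (+ 0) (+ 2) K u ⟨
    T g (+ 2) (K ⊕ u)                        ≡⟨ cong (T g (+ 2)) e ⟩
    T g (+ 2) (𝟛 ⊗ J ⊕ v)                    ≡⟨ T-+ g (+ 0) (+ 2) (𝟛 ⊗ J) v ⟩
    T g (+ 0) (𝟛 ⊗ J) ⊕ T g (+ 2) v          ≡⟨ cong (_⊕ T g (+ 2) v) (T-scale g (+ 3) J) ⟩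
    𝟛 ⊗ T g (+ 0) J ⊕ T g (+ 2) v            ∎

record Carries (g : D4) (x x′ : Word) (m : ℕ) (I : Pt) : Set where
  constructor carrying
  field carry : ∀ {K} → Fill x m K → Fill x′ m (T g (+ 0) K ⊕ I)
open Carries

-- Where all later letters correspond, root boxes go to root boxes at every level, so the
-- translation remains `𝟎` along the whole chain of ancestors on which the recursion runs.
carries-tail : ∀ {g x x′} m → (∀ i → m ℕ.≤ i → t (x′ i) ≡ T g (+ 2) (t (x i))) → Carries g x x′ m 𝟎
carries-tail {g} {x} {x′} m h .carry here = subst (Fill x′ m) (sym (cong (_⊕ 𝟎) (T-𝟎 g))) here
carries-tail {g} {x} {x′} m h .carry (there {K = K} J j e f) = there (T g (+ 0) J ⊕ 𝟎) (perm g j)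
  (trans (T-parent g K J 𝟎 𝟎 (t (x m)) (t j) (t (x′ m)) e (cong (𝟎 ⊕_) (h m ℕ.≤-refl)))
         (cong (𝟛 ⊗ (T g (+ 0) J ⊕ 𝟎) ⊕_) (sym (t-perm g j))))
  (carry (carries-tail {g} (suc m) (λ i l → h i (ℕ.<⇒≤ l))) f)

-- Below the common tail the letters may disagree; the mismatch is absorbed by the translation,
-- since the equation can always be solved for `I`.
carries-down : ∀ {g x x′} m I I₁ → I ⊕ t (x′ m) ≡ 𝟛 ⊗ I₁ ⊕ T g (+ 2) (t (x m)) →
  Carries g x x′ (suc m) I₁ → Carries g x x′ m I
carries-down {g} {x} {x′} m I I₁ h φ .carry {K} f with parent f
... | J , j , e , f′ = there (T g (+ 0) J ⊕ I₁) (perm g j)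
  (trans (T-parent g K J I I₁ (t (x m)) (t j) (t (x′ m)) e h)
         (cong (𝟛 ⊗ (T g (+ 0) J ⊕ I₁) ⊕_) (sym (t-perm g j))))
  (carry φ f′)

T-solve : ∀ g {u v} → u ≡ T g (+ 2) v → v ≡ T (inv g) (+ 2) u
T-solve g {v = v} refl = sym (T-invˡ g (+ 2) v)

-- The second translation is that of the inverse affine map; both directions descend together to
-- yield a bijection at level 0.
Symmetric : D4 → Word → Word → ℕ → Pt → Set
Symmetric g x x′ m I = Carries g x x′ m I × Carries (inv g) x′ x m (𝟎 ⊖ T (inv g) (+ 0) I)

symmetric-down : ∀ {g x x′} m I₁ → Symmetric g x x′ (suc m) I₁ → Σ Pt (Symmetric g x x′ m)
symmetric-down {g} {x} {x′} m I₁ (φ , ψ) = I , carries-down m I I₁ e φ , carries-down m (𝟎 ⊖ T h (+ 0) I) (𝟎 ⊖ T h (+ 0) I₁) e′ ψ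
  where
  open ≡-Reasoning
  h = inv g
  u = t (x m)
  u′ = t (x′ m)
  I = 𝟛 ⊗ I₁ ⊕ T g (+ 2) u ⊖ u′
  e : I ⊕ u′ ≡ 𝟛 ⊗ I₁ ⊕ T g (+ 2) u
  e = ≡×≡⇒≡ (solve 2 (λ p q → p :- q :+ q := p) (refl , refl) (𝟛 ⊗ I₁ ⊕ T g (+ 2) u) u′)
  e″ : T h (+ 0) I ⊕ T h (+ 2) u′ ≡ 𝟛 ⊗ T h (+ 0) I₁ ⊕ u
  e″ = begin
    T h (+ 0) I ⊕ T h (+ 2) u′                       ≡⟨ T-+ h (+ 0) (+ 2) I u′ ⟨
    T h (+ 2) (I ⊕ u′)                               ≡⟨ cong (T h (+ 2)) e ⟩
    T h (+ 2) (𝟛 ⊗ I₁ ⊕ T g (+ 2) u)                 ≡⟨ T-+ h (+ 0) (+ 2) (𝟛 ⊗ I₁) (T g (+ 2) u) ⟩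
    T h (+ 0) (𝟛 ⊗ I₁) ⊕ T h (+ 2) (T g (+ 2) u)     ≡⟨ cong₂ _⊕_ (T-scale h (+ 3) I₁) (T-invˡ g (+ 2) u) ⟩
    𝟛 ⊗ T h (+ 0) I₁ ⊕ u                             ∎
  e′ : 𝟎 ⊖ T h (+ 0) I ⊕ u ≡ 𝟛 ⊗ (𝟎 ⊖ T h (+ 0) I₁) ⊕ T h (+ 2) u′
  e′ = linear (sym e″) (≡×≡⇒≡ (solve 4 (λ i i₁ u v →
    con 𝟎 :- i :+ u :+ (i :+ v) := con 𝟛 :* (con 𝟎 :- i₁) :+ v :+ (con 𝟛 :* i₁ :+ u))
    (refl , refl) (T h (+ 0) I) (T h (+ 0) I₁) u (T h (+ 2) u′)))

symmetric-root : ∀ {g x x′} m {I} → Symmetric g x x′ m I → Σ Pt (Symmetric g x x′ zero)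
symmetric-root zero s = _ , s
symmetric-root {g} (suc m) {I} s = symmetric-root {g} m (proj₂ (symmetric-down {g} m I s))

-- Decision procedures for quantifiers over finite types

all-Bool? : ∀ {P : Bool → Set} → (∀ z → Dec (P z)) → Dec (∀ z → P z)
all-Bool? P? with P? false ×-dec P? true
... | yes (p , q) = yes λ { false → p ; true → q }
... | no ¬p = no λ p → ¬p (p false , p true)

all-D4? : ∀ {P : D4 → Set} → (∀ g → Dec (P g)) → Dec (∀ g → P g)
all-D4? P? with all-Bool? (λ s → all-Bool? (λ f₁ → all-Bool? (λ f₂ → P? (s , f₁ , f₂))))
... | yes p = yes λ { (s , f₁ , f₂) → p s f₁ f₂ }
... | no ¬p = no λ p → ¬p λ s f₁ f₂ → p (s , f₁ , f₂)

any-Bool? : ∀ {P : Bool → Set} → (∀ z → Dec (P z)) → Dec (Σ Bool P)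
any-Bool? P? with P? false | P? true
... | yes p | _ = yes (false , p)
... | no _ | yes q = yes (true , q)
... | no ¬p | no ¬q = no λ { (false , p) → ¬p p ; (true , q) → ¬q q }

any-D4? : ∀ {P : D4 → Set} → (∀ g → Dec (P g)) → Dec (Σ D4 P)
any-D4? P? with any-Bool? (λ s → any-Bool? (λ f₁ → any-Bool? (λ f₂ → P? (s , f₁ , f₂))))
... | yes (s , f₁ , f₂ , p) = yes ((s , f₁ , f₂) , p)
... | no ¬p = no λ { ((s , f₁ , f₂) , p) → ¬p (s , f₁ , f₂ , p) }

all-Y? : ∀ {P : Y → Set} → (∀ y → Dec (P y)) → Dec (∀ y → P y)
all-Y? P? with P? a ×-dec P? b ×-dec P? c ×-dec P? d
... | yes (p , q , r , s) = yes λ { a → p ; b → q ; c → r ; d → s }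
... | no ¬p = no λ p → ¬p (p a , p b , p c , p d)

any-Y? : ∀ {P : Y → Set} → (∀ y → Dec (P y)) → Dec (Σ Y P)
any-Y? P? with all-Y? (λ y → ¬? (P? y)) | P? a | P? b | P? c | P? d
... | _ | yes p | _ | _ | _ = yes (a , p)
... | _ | _ | yes p | _ | _ = yes (b , p)
... | _ | _ | _ | yes p | _ = yes (c , p)
... | _ | _ | _ | _ | yes p = yes (d , p)
... | _ | no p | no q | no r | no s = no λ { (a , z) → p z ; (b , z) → q z ; (c , z) → r z ; (d , z) → s z }

infix 4 _≟_
_≟_ : (p q : Pt) → Dec (p ≡ q)
_≟_ = ≡-dec ℤ._≟_ ℤ._≟_

-- Vertices and edges under a symmetry

T-UnitSide : ∀ g y → UnitSide (T g (+ 1) (pos y)) (T g (+ 1) (pos (next y)))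
T-UnitSide = toWitness {a? = all-D4? λ g → all-Y? λ y → any-Y? λ y′ →
  (T g (+ 1) (pos y) ≟ pos y′ ×-dec T g (+ 1) (pos (next y)) ≟ pos (next y′)) ⊎-dec
  (T g (+ 1) (pos (next y)) ≟ pos y′ ×-dec T g (+ 1) (pos y) ≟ pos (next y′))} _

T-corner : ∀ g I o u {p q} → p ≡ o ⊕ u → T g (+ 1) u ≡ q → T g (+ 1) p ⊕ I ≡ (T g (+ 0) o ⊕ I) ⊕ q
T-corner g I o u refl refl = trans (cong (_⊕ I) (T-+ g (+ 0) (+ 1) o u))
  (≡×≡⇒≡ (solve 3 (λ p q i → p :+ q :+ i := p :+ i :+ q) (refl , refl) (T g (+ 0) o) (T g (+ 1) u) I))

Carries-E : ∀ {g x x′ I} → Carries g x x′ zero I → ∀ {p q} → E x p q → E x′ (T g (+ 1) p ⊕ I) (T g (+ 1) q ⊕ I)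
Carries-E {g} {I = I} φ (edge o f y s) with T-UnitSide g y | s
... | y′ , inj₁ (e₁ , e₂) | ccw e e′ = edge _ (carry φ f) y′ (ccw (T-corner g I o (pos y) e e₁) (T-corner g I o (pos (next y)) e′ e₂))
... | y′ , inj₁ (e₁ , e₂) | cw e e′ = edge _ (carry φ f) y′ (cw (T-corner g I o (pos y) e e₁) (T-corner g I o (pos (next y)) e′ e₂))
... | y′ , inj₂ (e₁ , e₂) | ccw e e′ = edge _ (carry φ f) y′ (cw (T-corner g I o (pos (next y)) e′ e₁) (T-corner g I o (pos y) e e₂))
... | y′ , inj₂ (e₁ , e₂) | cw e e′ = edge _ (carry φ f) y′ (ccw (T-corner g I o (pos (next y)) e′ e₁) (T-corner g I o (pos y) e e₂))

Carries-V : ∀ {g x x′ I} → Carries g x x′ zero I → ∀ {p} → V x p → V x′ (T g (+ 1) p ⊕ I)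
Carries-V φ v = E⇒V (Carries-E φ (proj₂ (V⇒E v)))

affine-⊕ : ∀ g I p u → T g (+ 1) (p ⊕ u) ⊕ I ≡ T g (+ 1) p ⊕ I ⊕ T g (+ 0) u
affine-⊕ g I p u = trans (cong (_⊕ I) (T-translate g (+ 1) p u))
  (≡×≡⇒≡ (solve 3 (λ p q r → p :+ q :+ r := p :+ r :+ q) (refl , refl) (T g (+ 1) p) (T g (+ 0) u) I))

⊖-⊕ : ∀ p q → p ⊖ q ⊕ q ≡ p
⊖-⊕ p q = ≡×≡⇒≡ (solve 2 (λ p q → p :- q :+ q := p) (refl , refl) p q)

⊕-⊖ : ∀ p q → p ⊕ q ⊖ q ≡ p
⊕-⊖ p q = ≡×≡⇒≡ (solve 2 (λ p q → p :+ q :- q := p) (refl , refl) p q)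

T-inverse : ∀ {g h} I I′ → (∀ n p → T h n (T g n p) ≡ p) → T h (+ 0) I ⊕ I′ ≡ 𝟎 → ∀ p →
  T h (+ 1) (T g (+ 1) p ⊕ I) ⊕ I′ ≡ p
T-inverse {g} {h} I I′ inverse e p = begin
  T h (+ 1) (T g (+ 1) p ⊕ I) ⊕ I′                ≡⟨ cong (_⊕ I′) (T-translate h (+ 1) (T g (+ 1) p) I) ⟩
  T h (+ 1) (T g (+ 1) p) ⊕ T h (+ 0) I ⊕ I′      ≡⟨ cong (λ q → q ⊕ T h (+ 0) I ⊕ I′) (inverse (+ 1) p) ⟩
  p ⊕ T h (+ 0) I ⊕ I′                            ≡⟨ linear e (≡×≡⇒≡ (solve 3 (λ p i j → p :+ i :+ j :+ con 𝟎 := p :+ (i :+ j)) (refl , refl) p (T h (+ 0) I) I′)) ⟩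
  p                                               ∎
  where open ≡-Reasoning

pt-injective : ∀ {y x} {u v : VΓ y x} → pt u ≡ pt v → u ≡ v
pt-injective refl = refl

Symmetric⇒Iso : ∀ {g x x′ I} y y′ → Symmetric g x x′ zero I → GraphIso y x y′ x′
Symmetric⇒Iso {g} {x} {x′} {I} y y′ (φ , ψ) = mk↔ₛ′ to from to-from from-to , λ u v → mk⇔ (edge⇒ u v) (edge⇐ u v)
  where
  open ≡-Reasoning
  h = inv g
  I′ = 𝟎 ⊖ T h (+ 0) I

  A B : Pt → Pt
  A p = T g (+ 1) p ⊕ I
  B p = T h (+ 1) p ⊕ I′

  B-A : ∀ p → B (A p) ≡ p
  B-A = T-inverse I I′ (T-invˡ g) (≡×≡⇒≡ (solve 1 (λ i → i :+ (con 𝟎 :- i) := con 𝟎) (refl , refl) (T h (+ 0) I)))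

  A-B : ∀ p → A (B p) ≡ p
  A-B = T-inverse I′ I (T-invʳ g) (linear (sym (T-+ g (+ 0) (+ 0) I′ (T h (+ 0) I)))
    (linear (trans (cong (T g (+ 0)) (≡×≡⇒≡ (solve 1 (λ i → con 𝟎 :- i :+ i := con 𝟎) (refl , refl) (T h (+ 0) I)))) (T-𝟎 g))
    (linear (sym (T-invʳ g (+ 0) I)) (≡×≡⇒≡
      (solve 4 (λ i l m n → l :+ i :+ m :+ con 𝟎 :+ n := con 𝟎 :+ (l :+ n) :+ m :+ i)
        (refl , refl) I (T g (+ 0) I′) (T g (+ 0) (I′ ⊕ T h (+ 0) I)) (T g (+ 0) (T h (+ 0) I)))))))

  to : VΓ y x → VΓ y′ x′
  to (vtx p v) = vtx (A (p ⊕ pos y) ⊖ pos y′)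
    (V⇒VInf {y′} {x′} {A (p ⊕ pos y) ⊖ pos y′} (subst (V x′) (sym (⊖-⊕ (A (p ⊕ pos y)) (pos y′))) (Carries-V φ (VInf⇒V {y} {x} {p} v))))

  from : VΓ y′ x′ → VΓ y x
  from (vtx p v) = vtx (B (p ⊕ pos y′) ⊖ pos y)
    (V⇒VInf {y} {x} {B (p ⊕ pos y′) ⊖ pos y} (subst (V x) (sym (⊖-⊕ (B (p ⊕ pos y′)) (pos y))) (Carries-V ψ (VInf⇒V {y′} {x′} {p} v))))

  cancel : ∀ {f g : Pt → Pt} {q q′} → (∀ p → f (g p) ≡ p) → ∀ p → f (g (p ⊕ q) ⊖ q′ ⊕ q′) ⊖ q ≡ p
  cancel {f} {g} {q} {q′} f-g p = begin
    f (g (p ⊕ q) ⊖ q′ ⊕ q′) ⊖ q    ≡⟨ cong (λ z → f z ⊖ q) (⊖-⊕ (g (p ⊕ q)) q′) ⟩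
    f (g (p ⊕ q)) ⊖ q              ≡⟨ cong (_⊖ q) (f-g (p ⊕ q)) ⟩
    p ⊕ q ⊖ q                      ≡⟨ ⊕-⊖ p q ⟩
    p                              ∎

  to-from : ∀ u → to (from u) ≡ u
  to-from u = pt-injective (cancel {A} {B} {pos y′} {pos y} A-B (pt u))

  from-to : ∀ u → from (to u) ≡ u
  from-to u = pt-injective (cancel {B} {A} {pos y} {pos y′} B-A (pt u))

  edge⇒ : ∀ u v → AdjInf y x (pt u) (pt v) → AdjInf y′ x′ (pt (to u)) (pt (to v))
  edge⇒ u v e = E⇒AdjInf {y′} {x′} {pt (to u)} {pt (to v)}
    (subst₂ (E x′) (sym (⊖-⊕ (A (pt u ⊕ pos y)) (pos y′))) (sym (⊖-⊕ (A (pt v ⊕ pos y)) (pos y′)))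
    (Carries-E φ (AdjInf⇒E {y} {x} {pt u} {pt v} e)))

  edge⇐ : ∀ u v → AdjInf y′ x′ (pt (to u)) (pt (to v)) → AdjInf y x (pt u) (pt v)
  edge⇐ u v e = E⇒AdjInf {y} {x} {pt u} {pt v} (subst₂ (E x) (back (pt u)) (back (pt v)) (Carries-E ψ (AdjInf⇒E {y′} {x′} {pt (to u)} {pt (to v)} e)))
    where
    back : ∀ p → B (A (p ⊕ pos y) ⊖ pos y′ ⊕ pos y′) ≡ p ⊕ pos y
    back p = trans (cong B (⊖-⊕ (A (p ⊕ pos y)) (pos y′))) (B-A (p ⊕ pos y))

Cofinal⇒Iso : ∀ y y′ x x′ σ → InG σ → Cofinal x′ (σ ∘ x) → GraphIso y x y′ x′
Cofinal⇒Iso y y′ x x′ σ (ws , σ≡) (N , tail) =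
  Symmetric⇒Iso {g} y y′ (proj₂ (symmetric-root {g} N {𝟎} (carries-tail N digits ,
    subst (Carries (inv g) x′ x N) (sym (cong (𝟎 ⊖_) (T-𝟎 (inv g)))) (carries-tail N λ i l → T-solve g (digits i l)))))
  where
  g = symmetry ws
  digits : ∀ i → N ℕ.≤ i → t (x′ i) ≡ T g (+ 2) (t (x i))
  digits i l = trans (cong t (trans (tail i l) (σ≡ (x i)))) (t-evalWord ws (x i))

-- Rigidity: an isomorphism is the restriction of a symmetry of ℤ²

-- An isomorphism as a relation between points, which carries no (irrelevant)
-- proofs that these points are vertices.
record Correspondence (x x′ : Word) : Set₁ where
  field
    R          : Pt → Pt → Set
    total      : ∀ {p} → V x p → Σ Pt (R p)
    onto       : ∀ {q} → V x′ q → Σ Pt λ p → V x p × R p q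
    functional : ∀ {p q q′} → R p q → R p q′ → q ≡ q′
    injective  : ∀ {p p′ q} → R p q → R p′ q → p ≡ p′
    edges      : ∀ {p p′ q q′} → R p q → R p′ q′ → E x p p′ → E x′ q q′

⊕-cancelʳ : ∀ p q r → p ⊕ r ≡ q ⊕ r → p ≡ q
⊕-cancelʳ p q r e = linear e (≡×≡⇒≡ (solve 3 (λ p q r → p :+ (q :+ r) := q :+ (p :+ r)) (refl , refl) p q r))

Iso⇒Correspondence : ∀ {y x y′ x′} → GraphIso y x y′ x′ → Correspondence x x′
Iso⇒Correspondence {y} {x} {y′} {x′} (f , adj) = record
  { R          = R
  ; total      = λ {p} v → _ , at v , sym (⊖-⊕ p (pos y)) , refl
  ; onto       = onto
  ; functional = functional
  ; injective  = injective
  ; edges      = edges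
  }
  where
  to = Inverse.to f
  from = Inverse.from f

  R : Pt → Pt → Set
  R p q = Σ (VΓ y x) λ u → p ≡ pt u ⊕ pos y × q ≡ pt (to u) ⊕ pos y′

  at : ∀ {y x p} → V x p → VΓ y x
  at {y} {x} {p} v = vtx (p ⊖ pos y) (V⇒VInf {y} {x} {p ⊖ pos y} (subst (V x) (sym (⊖-⊕ p (pos y))) v))

  functional : ∀ {p q q′} → R p q → R p q′ → q ≡ q′
  functional (u , e , refl) (u′ , e′ , refl) =
    cong (λ u → pt (to u) ⊕ pos y′) (pt-injective {u = u} {u′} (⊕-cancelʳ (pt u) (pt u′) (pos y) (trans (sym e) e′)))

  injective : ∀ {p p′ q} → R p q → R p′ q → p ≡ p′
  injective (u , refl , e) (u′ , refl , e′) = cong (λ u → pt u ⊕ pos y)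
    (trans (sym (Inverse.strictlyInverseʳ f u)) (trans (cong from
      (pt-injective {u = to u} {to u′} (⊕-cancelʳ (pt (to u)) (pt (to u′)) (pos y′) (trans (sym e) e′))))
      (Inverse.strictlyInverseʳ f u′)))

  edges : ∀ {p p′ q q′} → R p q → R p′ q′ → E x p p′ → E x′ q q′
  edges (u , refl , refl) (u′ , refl , refl) e =
    AdjInf⇒E {y′} {x′} {pt (to u)} {pt (to u′)} (Equivalence.to (adj u u′) (E⇒AdjInf {y} {x} {pt u} {pt u′} e))

  onto : ∀ {q} → V x′ q → Σ Pt λ p → V x p × R p q
  -- The membership proof inside `VΓ` is irrelevant and cannot be extracted for the preimage.
  -- Instead an edge at `q` is pulled back, and its endpoint is a vertex.
  onto {q} v with V⇒E v
  ... | q₁ , e = pt u ⊕ pos y ,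
      E⇒V (AdjInf⇒E {y} {x} {pt u} {pt u₁} (Equivalence.from (adj u u₁)
        (E⇒AdjInf {y′} {x′} {pt (to u)} {pt (to u₁)} (subst₂ (E x′) (image v) (image v₁) e)))) ,
      u , refl , image v
    where
    v₁ = E⇒V (E-sym e)
    u u₁ : VΓ y x
    u = from (at v)
    u₁ = from (at v₁)
    image : ∀ {q} (v : V x′ q) → q ≡ pt (to (from (at v))) ⊕ pos y′
    image {q} v = trans (sym (⊖-⊕ q (pos y′))) (cong (λ u → pt u ⊕ pos y′) (sym (Inverse.strictlyInverseˡ f (at v))))

-- Y also indexes the four directions: dir y points from the corner y to next y.
dir : Y → Pt
dir y = pos (next y) ⊖ pos y

opp : Y → Y
opp y = next (next y)

E-dir : ∀ {x p q} → E x p q → Σ Y λ i → q ≡ p ⊕ dir i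
E-dir {p = p} {q} (edge o f y (ccw e e′)) = y , linear e′ (linear (sym e) (≡×≡⇒≡
  (solve 5 (λ p q o u v → q :+ (o :+ v) :+ p := p :+ (v :- u) :+ q :+ (o :+ u)) (refl , refl) p q o (pos y) (pos (next y)))))
E-dir {p = p} {q} (edge o f y (cw e e′)) = opp y , linear e (linear (sym e′) (linear (sym (dir-opp y)) (≡×≡⇒≡
  (solve 6 (λ p q o u v w → q :+ (o :+ u) :+ p :+ w := p :+ w :+ q :+ (o :+ v) :+ (u :- v))
    (refl , refl) p q o (pos y) (pos (next y)) (dir (opp y))))))
  where
  dir-opp : ∀ y → dir (opp y) ≡ pos y ⊖ pos (next y)
  dir-opp = toWitness {a? = all-Y? λ y → _ ≟ _} _

-- The two routes a–b–c and a–d–c around the image of a unit square.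
unit-square : ∀ i j l n → dir i ≢ dir j → dir i ⊕ dir l ≢ 𝟎 → dir i ⊕ dir l ≡ dir j ⊕ dir n →
  Σ D4 λ g → T g (+ 0) (dir a) ≡ dir i × T g (+ 0) (dir b) ≡ dir j × dir l ≡ dir j
unit-square = toWitness {a? = all-Y? λ i → all-Y? λ j → all-Y? λ l → all-Y? λ n →
  ¬? (dir i ≟ dir j) →-dec (¬? (dir i ⊕ dir l ≟ 𝟎) →-dec (dir i ⊕ dir l ≟ dir j ⊕ dir n →-dec
  any-D4? λ g → T g (+ 0) (dir a) ≟ dir i ×-dec (T g (+ 0) (dir b) ≟ dir j ×-dec dir l ≟ dir j)))} _

-- A unit square adjacent to a square mapped by g is mapped by g as well, being
-- the only square on the free side of the image of the common side: dir i and
-- dir j are the images of the two sides perpendicular to the common one.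
adjacent-square : ∀ g y i j l →
  dir i ≢ T g (+ 0) (dir (next y)) → dir i ≢ T g (+ 0) (dir (opp y)) →
  dir j ≢ T g (+ 0) (dir (opp (next y))) → dir j ≢ T g (+ 0) (dir (opp y)) →
  T g (+ 0) (dir (next y)) ⊕ dir j ≡ dir i ⊕ dir l →
  dir i ≡ T g (+ 0) (dir y) × dir j ≡ T g (+ 0) (dir y)
adjacent-square = toWitness {a? = all-D4? λ g → all-Y? λ y → all-Y? λ i → all-Y? λ j → all-Y? λ l →
  ¬? (dir i ≟ T g (+ 0) (dir (next y))) →-dec (¬? (dir i ≟ T g (+ 0) (dir (opp y))) →-dec
  (¬? (dir j ≟ T g (+ 0) (dir (opp (next y)))) →-dec (¬? (dir j ≟ T g (+ 0) (dir (opp y))) →-dec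
  (T g (+ 0) (dir (next y)) ⊕ dir j ≟ dir i ⊕ dir l →-dec
  (dir i ≟ T g (+ 0) (dir y) ×-dec dir j ≟ T g (+ 0) (dir y))))))} _

dir-next≢ : ∀ y → dir y ≢ dir (next y)
dir-next≢ = toWitness {a? = all-Y? λ y → ¬? (dir y ≟ dir (next y))} _

dir-prev≢ : ∀ y → dir y ≢ dir (opp (next y))
dir-prev≢ = toWitness {a? = all-Y? λ y → ¬? (dir y ≟ dir (opp (next y)))} _

dir-opp≢ : ∀ y → dir y ≢ dir (opp y)
dir-opp≢ = toWitness {a? = all-Y? λ y → ¬? (dir y ≟ dir (opp y))} _

dir-opp : ∀ y → dir y ⊕ dir (opp y) ≡ 𝟎
dir-opp = toWitness {a? = all-Y? λ y → _ ≟ _} _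

pos-opp : ∀ y → pos (opp y) ≡ pos (next (opp y)) ⊕ dir y
pos-opp = toWitness {a? = all-Y? λ y → _ ≟ _} _

around : ∀ {P : Y → Set} y → P y → P (next y) → P (opp y) → P (next (opp y)) → ∀ z → P z
around a p q r s = λ { a → p ; b → q ; c → r ; d → s }
around b p q r s = λ { b → p ; c → q ; d → r ; a → s }
around c p q r s = λ { c → p ; d → q ; a → r ; b → s }
around d p q r s = λ { d → p ; a → q ; b → r ; c → s }

E-side : ∀ {x o} → Fill x zero o → ∀ y → E x (o ⊕ pos y) (o ⊕ pos (next y))
E-side {o = o} f y = edge o f y (ccw refl refl)

-- Doubling forces `w` into {0,1}², with `j` one of the corner positions 0, 2, 4, 6; so `w` names a
-- corner of a box.
data Half : Pt → Set where
  half : ∀ {w} j → t j ≡ w ⊕ w → Half w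

-- The corner cell of the corner copy is the corner cell of the whole box: `3s − 1 = (s − 1) + 2s`.
corner-Cell : ∀ k {w} → Half w → Cell k ((𝕤 k ⊖ 𝟏) ⊗ w)
corner-Cell zero {w} h = subst (Cell zero) (≡×≡⇒≡ (solve 1 (λ w → con 𝟎 := (con (𝕤 0) :- con 𝟏) :* w) (refl , refl) w)) unit
corner-Cell (suc k) {w} h@(half j e) = subst (Cell (suc k)) (linear (cong (𝕤 k ⊗_) e) (≡×≡⇒≡
  (solve 3 (λ s w u → (s :- con 𝟏) :* w :+ s :* u :+ s :* (w :+ w) := (con 𝟛 :* s :- con 𝟏) :* w :+ s :* u)
    (refl , refl) (𝕤 k) w (t j))))
  (copy (corner-Cell k h) j)

-- The copies 0, 1, …, 7 form a cycle around the central hole.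
cycle : X → X
cycle = lookup (# 1 ∷ # 2 ∷ # 3 ∷ # 4 ∷ # 5 ∷ # 6 ∷ # 7 ∷ # 0 ∷ [])

along : ∀ (Q : X → Set) → (∀ j → Q j → Q (cycle j)) → ∀ j j′ → Q j → Q j′
along Q step j j′ q = subst Q (proj₂ (reach j j′)) (go (toℕ (proj₁ (reach j j′))) q)
  where
  iterate : ℕ → X → X
  iterate zero j = j
  iterate (suc n) j = iterate n (cycle j)
  go : ∀ n {j} → Q j → Q (iterate n j)
  go zero q = q
  go (suc n) q = go n (step _ q)
  reach : ∀ j j′ → Σ X λ n → iterate (toℕ n) j ≡ j′
  reach = toWitness {a? = Fin.all? λ j → Fin.all? λ j′ → Fin.any? λ n → iterate (toℕ n) j Fin.≟ j′} _

-- The corner cell of copy j at (𝕤 k ⊖ 𝟏) ⊗ w₁ has the corner cell of the next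
-- copy at (𝕤 k ⊖ 𝟏) ⊗ w₂ as its neighbour in direction y.
data Turn (j : X) : Set where
  turn : ∀ y w₁ w₂ → Half w₁ → Half w₂ → t (cycle j) ≡ t j ⊕ dir y → w₁ ≡ w₂ ⊕ dir y → Turn j

turns : ∀ j → Turn j
turns = λ where
    0F → east refl
    1F → east refl
    2F → north refl
    3F → north refl
    4F → west refl
    5F → west refl
    6F → south refl
    7F → south refl
  where
  h₀ = half {𝟎} 0F refl
  h₁ = half {+ 1 , + 0} 2F refl
  h₂ = half {+ 0 , + 1} 6F refl
  east : ∀ {j} → t (cycle j) ≡ t j ⊕ dir a → Turn j
  east e = turn a _ _ h₁ h₀ e refl
  north : ∀ {j} → t (cycle j) ≡ t j ⊕ dir b → Turn j
  north e = turn b _ _ h₂ h₀ e refl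
  west : ∀ {j} → t (cycle j) ≡ t j ⊕ dir c → Turn j
  west e = turn c _ _ h₀ h₁ e refl
  south : ∀ {j} → t (cycle j) ≡ t j ⊕ dir d → Turn j
  south e = turn d _ _ h₀ h₂ e refl

offset-Cell : ∀ x k → Cell k (offset x k)
offset-Cell x zero = unit
offset-Cell x (suc k) = copy (offset-Cell x k) (x k)

-- Propagation of a symmetry from one square to all

module Propagate {x x′} (C : Correspondence x x′) (g : D4) (I : Pt) where
  open Correspondence C

  A : Pt → Pt
  A p = T g (+ 1) p ⊕ I

  D : Y → Pt
  D y = T g (+ 0) (dir y)

  A-⊕ : ∀ p u → A (p ⊕ u) ≡ A p ⊕ T g (+ 0) u
  A-⊕ = affine-⊕ g I

  record Good (p : Pt) : Set where
    constructor good
    field is : R p (A p)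
  open Good

  GoodCell : Pt → Set
  GoodCell o = ∀ y → Good (o ⊕ pos y)

  -- By injectivity: the point `A p ⊕ D k` is already taken by the image of another neighbour of
  -- `p`.
  avoid : ∀ p e k {q} → Good (p ⊕ dir k) → R (p ⊕ dir e) q → dir e ≢ dir k → ∀ i → q ≡ A p ⊕ dir i → dir i ≢ D k
  avoid p e k (good r) r′ e≢k i q≡ i≡ = e≢k (⊕-cancelˡ p (injective r′
    (subst (R (p ⊕ dir k)) (sym (trans q≡ (trans (cong (A p ⊕_) i≡) (sym (A-⊕ p (dir k)))))) r)))

  -- The common side runs from `p` to `q`. At each end two neighbours are already placed, which
  -- excludes two directions for the new corner; the edge between the new corners leaves a single
  -- choice.
  cross-side : ∀ p y → let q = p ⊕ dir (next y) in
    Good p → Good q → Good (p ⊕ dir (opp y)) → Good (q ⊕ dir (opp y)) →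
    E x p (p ⊕ dir y) → E x q (q ⊕ dir y) → E x (p ⊕ dir y) (q ⊕ dir y) →
    Good (p ⊕ dir y) × Good (q ⊕ dir y)
  cross-side p y gp gq gp′ gq′ ep eq er =
    finish (E-dir (edges (is gp) Rr ep)) (E-dir (edges (is gq) Rs eq)) (E-dir (edges Rr Rs er))
    where
    q = p ⊕ dir (next y)
    r = proj₁ (total (E⇒V (E-sym ep)))
    Rr = proj₂ (total (E⇒V (E-sym ep)))
    s = proj₁ (total (E⇒V (E-sym eq)))
    Rs = proj₂ (total (E⇒V (E-sym eq)))
    back : Good (q ⊕ dir (opp (next y)))
    back = subst Good (linear (sym (dir-opp (next y))) (≡×≡⇒≡
      (solve 3 (λ p u v → p :+ (u :+ v) := p :+ u :+ v :+ con 𝟎) (refl , refl) p (dir (next y)) (dir (opp (next y)))))) gp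
    lemma : ∀ P Q u j i l r s → Q ≡ P ⊕ u → r ≡ P ⊕ i → s ≡ Q ⊕ j → s ≡ r ⊕ l → u ⊕ j ≡ i ⊕ l
    lemma P Q u j i l r s refl refl e refl = linear (sym e) (≡×≡⇒≡
      (solve 5 (λ P u j i l → u :+ j :+ (P :+ i :+ l) := i :+ l :+ (P :+ u :+ j)) (refl , refl) P u j i l))
    reached : ∀ p i {q} → R (p ⊕ dir y) q → q ≡ A p ⊕ dir i → dir i ≡ D y → Good (p ⊕ dir y)
    reached p i ρ q≡ i≡ = good (subst (R _) (trans q≡ (trans (cong (A p ⊕_) i≡) (sym (A-⊕ p (dir y))))) ρ)
    finish : Σ Y (λ i → r ≡ A p ⊕ dir i) → Σ Y (λ j → s ≡ A q ⊕ dir j) → Σ Y (λ l → s ≡ r ⊕ dir l) →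
      Good (p ⊕ dir y) × Good (q ⊕ dir y)
    finish (i , r≡) (j , s≡) (l , s≡′) = reached p i Rr r≡ (proj₁ ij) , reached q j Rs s≡ (proj₂ ij)
      where
      ij : dir i ≡ D y × dir j ≡ D y
      ij = adjacent-square g y i j l
        (avoid p y (next y) gq Rr (dir-next≢ y) i r≡) (avoid p y (opp y) gp′ Rr (dir-opp≢ y) i r≡)
        (avoid q y (opp (next y)) back Rs (dir-prev≢ y) j s≡) (avoid q y (opp y) gq′ Rs (dir-opp≢ y) j s≡)
        (lemma (A p) (A q) (D (next y)) (dir j) (dir i) (dir l) r s (A-⊕ p (dir (next y))) r≡ s≡ s≡′)

  cross : ∀ {o} y → Fill x zero o → Fill x zero (o ⊕ dir y) → GoodCell o → GoodCell (o ⊕ dir y)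
  cross {o} y f f′ G = around y
    (subst Good eq₁ (G y₁))
    (subst Good eq₂ (proj₁ new))
    (subst Good eq₃ (proj₂ new))
    (subst Good eq₄ (G y₂))
    where
    y₁ = next y
    y₂ = next y₁
    y₃ = next y₂
    p = o ⊕ pos y₁
    q = p ⊕ dir y₁
    q≡ : o ⊕ pos y₂ ≡ q
    q≡ = ≡×≡⇒≡ (solve 3 (λ o u v → o :+ v := o :+ u :+ (v :- u)) (refl , refl) o (pos y₁) (pos y₂))
    eq₁ : p ≡ o ⊕ dir y ⊕ pos y
    eq₁ = ≡×≡⇒≡ (solve 3 (λ o u v → o :+ v := o :+ (v :- u) :+ u) (refl , refl) o (pos y) (pos y₁))
    eq₂ : p ⊕ dir y ≡ o ⊕ dir y ⊕ pos y₁
    eq₂ = ≡×≡⇒≡ (solve 3 (λ o u v → o :+ v :+ u := o :+ u :+ v) (refl , refl) o (dir y) (pos y₁))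
    eq₃ : q ⊕ dir y ≡ o ⊕ dir y ⊕ pos y₂
    eq₃ = ≡×≡⇒≡ (solve 4 (λ o w u v → o :+ u :+ (v :- u) :+ w := o :+ w :+ v) (refl , refl) o (dir y) (pos y₁) (pos y₂))
    eq₄ : o ⊕ pos y₂ ≡ o ⊕ dir y ⊕ pos y₃
    eq₄ = linear (pos-opp y) (≡×≡⇒≡ (solve 4 (λ o w u v → o :+ u :+ (v :+ w) := o :+ w :+ v :+ u) (refl , refl) o (dir y) (pos y₂) (pos y₃)))
    back₁ : o ⊕ pos y ≡ p ⊕ dir y₂
    back₁ = linear (sym (dir-opp y)) (≡×≡⇒≡
      (solve 4 (λ o u v w → o :+ u :+ (v :- u :+ w) := o :+ v :+ w :+ con 𝟎) (refl , refl) o (pos y) (pos y₁) (dir y₂)))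
    back₂ : o ⊕ pos y₃ ≡ q ⊕ dir y₂
    back₂ = ≡×≡⇒≡ (solve 4 (λ o u v w → o :+ w := o :+ u :+ (v :- u) :+ (w :- v)) (refl , refl) o (pos y₁) (pos y₂) (pos y₃))
    new : Good (p ⊕ dir y) × Good (q ⊕ dir y)
    new = cross-side p y (G y₁) (subst Good q≡ (G y₂)) (subst Good back₁ (G y)) (subst Good back₂ (G y₃))
      (subst₂ (E x) (sym eq₁) (sym eq₂) (E-side f′ y))
      (E-sym (subst₂ (E x) (sym eq₃) (trans (sym eq₄) q≡) (E-side f′ y₂)))
      (subst₂ (E x) (sym eq₂) (sym eq₃) (E-side f′ y₁))

  -- Within one copy the induction hypothesis reaches every cell. Consecutive copies around the hole
  -- touch in corner cells, so crossing the side between these passes on to the next copy.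
  connected : ∀ k o → (∀ {r} → Cell k r → Fill x zero (o ⊕ r)) →
    ∀ {r r′} → Cell k r → Cell k r′ → GoodCell (o ⊕ r) → GoodCell (o ⊕ r′)
  connected zero o full unit unit G = G
  connected (suc k) o full (copy {r = r} s j) (copy {r = r′} s′ j′) G =
    subst GoodCell (sym (assoc j′ r′)) (along Q step j j′ (λ s′ → connected k (base j) (full′ j) s s′ (subst GoodCell (assoc j r) G)) s′)
    where
    base : X → Pt
    base j = o ⊕ 𝕤 k ⊗ t j
    assoc : ∀ j r → o ⊕ (r ⊕ 𝕤 k ⊗ t j) ≡ base j ⊕ r
    assoc j r = ≡×≡⇒≡ (solve 3 (λ o r u → o :+ (r :+ u) := o :+ u :+ r) (refl , refl) o r (𝕤 k ⊗ t j))
    full′ : ∀ j {r} → Cell k r → Fill x zero (base j ⊕ r)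
    full′ j {r} s = subst (Fill x zero) (assoc j r) (full (copy s j))
    Q : X → Set
    Q j = ∀ {r} → Cell k r → GoodCell (base j ⊕ r)
    step : ∀ j → Q j → Q (cycle j)
    step j q with turns j
    ... | turn y w₁ w₂ h₁ h₂ e e′ = λ s → connected k (base (cycle j)) (full′ (cycle j)) (corner-Cell k h₂) s
          (subst GoodCell eq (cross y (full′ j (corner-Cell k h₁))
            (subst (Fill x zero) (sym eq) (full′ (cycle j) (corner-Cell k h₂)))
            (q (corner-Cell k h₁))))
      where
      eq : base j ⊕ (𝕤 k ⊖ 𝟏) ⊗ w₁ ⊕ dir y ≡ base (cycle j) ⊕ (𝕤 k ⊖ 𝟏) ⊗ w₂
      eq = linear (cong ((𝕤 k ⊖ 𝟏) ⊗_) e′) (linear (cong (𝕤 k ⊗_) (sym e)) (≡×≡⇒≡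
        (solve 7 (λ o s u u′ w₁ w₂ v → let m = s :- con 𝟏 in
            o :+ s :* u :+ m :* w₁ :+ v :+ m :* (w₂ :+ v) :+ s :* u′
            := o :+ s :* u′ :+ m :* w₂ :+ m :* w₁ :+ s :* (u :+ v))
          (refl , refl) o (𝕤 k) (t j) (t (cycle j)) w₁ w₂ (dir y))))

  -- The root's cell and the cell of `p` lie together in the root's box of some level `k`, all of
  -- whose cells are filled.
  everywhere : GoodCell 𝟎 → ∀ {p} → V x p → Good p
  everywhere G (corner o f y refl) with enclosing f unit
  ... | k , s = subst (λ o → Good (o ⊕ pos y)) end (connected k (𝟎 ⊖ offset x k) full (offset-Cell x k) s (subst GoodCell start G) y)
    where
    start : 𝟎 ≡ 𝟎 ⊖ offset x k ⊕ offset x k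
    start = sym (⊖-⊕ 𝟎 (offset x k))
    end : 𝟎 ⊖ offset x k ⊕ (𝕤 0 ⊗ o ⊕ 𝟎 ⊖ 𝟎 ⊕ offset x k) ≡ o
    end = ≡×≡⇒≡ (solve 2 (λ o r → con 𝟎 :- r :+ (con (𝕤 0) :* o :+ con 𝟎 :- con 𝟎 :+ r) := o) (refl , refl) o (offset x k))
    full : ∀ {r} → Cell k r → Fill x zero (𝟎 ⊖ offset x k ⊕ r)
    full {r} s = subst (Fill x zero) (≡×≡⇒≡ (solve 3 (λ s r o → s :* con 𝟎 :+ r :- o := con 𝟎 :- o :+ r) (refl , refl) (𝕤 k) r (offset x k)))
      (subcell here s)

rigid : ∀ {x x′} (C : Correspondence x x′) → let open Correspondence C in
  Σ D4 λ g → Σ Pt λ I → ∀ {p} → V x p → R p (T g (+ 1) p ⊕ I)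
rigid {x} C = finish (E-dir (edges Rp Rq (E-side here a))) (E-dir (edges Rp Rs (E-sym (E-side here d))))
                     (E-dir (edges Rq Rr (E-side here b))) (E-dir (edges Rs Rr (E-sym (E-side here c))))
  where
  open Correspondence C
  image : ∀ y → Σ Pt (R (𝟎 ⊕ pos y))
  image y = total (E⇒V (E-side here y))
  p = proj₁ (image a)
  q = proj₁ (image b)
  r = proj₁ (image c)
  s = proj₁ (image d)
  Rp = proj₂ (image a)
  Rq = proj₂ (image b)
  Rr = proj₂ (image c)
  Rs = proj₂ (image d)
  two-steps : ∀ p q r i l → q ≡ p ⊕ i → r ≡ q ⊕ l → r ≡ p ⊕ (i ⊕ l)
  two-steps p q r i l refl refl = ≡×≡⇒≡ (solve 3 (λ p i l → p :+ i :+ l := p :+ (i :+ l)) (refl , refl) p i l)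
  finish : Σ Y (λ i → q ≡ p ⊕ dir i) → Σ Y (λ j → s ≡ p ⊕ dir j) → Σ Y (λ l → r ≡ q ⊕ dir l) → Σ Y (λ n → r ≡ s ⊕ dir n) →
    Σ D4 λ g → Σ Pt λ I → ∀ {p} → V x p → R p (T g (+ 1) p ⊕ I)
  finish (i , q≡) (j , s≡) (l , r≡) (n , r≡′) = g , I , λ v → Good.is (everywhere root-good v)
    where
    -- Equal directions would give corners `b` and `d` the same image; turning straight back would
    -- do so for `a` and `c`.
    i≢j : dir i ≢ dir j
    i≢j e = case injective Rq (subst (R (𝟎 ⊕ pos d)) (trans s≡ (trans (cong (p ⊕_) (sym e)) (sym q≡))) Rs) of λ ()
    turned : dir i ⊕ dir l ≢ 𝟎
    turned e = case injective Rp (subst (R (𝟎 ⊕ pos c)) (trans (two-steps p q r (dir i) (dir l) q≡ r≡)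
      (trans (cong (p ⊕_) e) (≡×≡⇒≡ (solve 1 (λ p → p :+ con 𝟎 := p) (refl , refl) p)))) Rr) of λ ()
    square : Σ D4 λ g → T g (+ 0) (dir a) ≡ dir i × T g (+ 0) (dir b) ≡ dir j × dir l ≡ dir j
    square = unit-square i j l n i≢j turned
      (⊕-cancelˡ p (trans (sym (two-steps p q r (dir i) (dir l) q≡ r≡)) (two-steps p s r (dir j) (dir n) s≡ r≡′)))
    g = proj₁ square
    gi = proj₁ (proj₂ square)
    gj = proj₁ (proj₂ (proj₂ square))
    l≡j = proj₂ (proj₂ (proj₂ square))
    I = p ⊖ T g (+ 1) 𝟎
    open Propagate C g I
    Aa : p ≡ A (𝟎 ⊕ pos a)
    Aa = ≡×≡⇒≡ (solve 2 (λ p q → p := q :+ (p :- q)) (refl , refl) p (T g (+ 1) 𝟎))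
    Ab : q ≡ A (𝟎 ⊕ pos b)
    Ab = trans q≡ (trans (cong₂ _⊕_ Aa (sym gi)) (sym (A-⊕ (𝟎 ⊕ pos a) (dir a))))
    Ad : s ≡ A (𝟎 ⊕ pos d)
    Ad = trans s≡ (trans (cong₂ _⊕_ Aa (sym gj)) (sym (A-⊕ (𝟎 ⊕ pos a) (dir b))))
    Ac : r ≡ A (𝟎 ⊕ pos c)
    Ac = trans r≡ (trans (cong₂ _⊕_ Ab (trans l≡j (sym gj))) (sym (A-⊕ (𝟎 ⊕ pos b) (dir b))))
    root-good : GoodCell 𝟎
    root-good a = good (subst (R (𝟎 ⊕ pos a)) Aa Rp)
    root-good b = good (subst (R (𝟎 ⊕ pos b)) Ab Rq)
    root-good c = good (subst (R (𝟎 ⊕ pos c)) Ac Rr)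
    root-good d = good (subst (R (𝟎 ⊕ pos d)) Ad Rs)

-- Digits in base 3

Below : ℕ → ℤ → Set
Below N z = Σ ℕ λ n → z ≡ + n × n ℕ.< N

Inside : ℕ → ℤ → Set
Inside N z = Σ ℕ λ n → z ≡ + n × 0 ℕ.< n × n ℕ.< N

Below² Inside² : ℕ → Pt → Set
Below² N p = Below N (proj₁ p) × Below N (proj₂ p)
Inside² N p = Inside N (proj₁ p) × Inside N (proj₂ p)

small-multiple : ∀ N z → ∣ + N ℤ.* z ∣ ℕ.< N → z ≡ + 0
small-multiple N z l = ℤ.∣i∣≡0⇒i≡0 (go ∣ z ∣ (subst (ℕ._< N) (ℤ.abs-* (+ N) z) l))
  where
  go : ∀ n → N ℕ.* n ℕ.< N → n ≡ 0
  go zero _ = refl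
  go (suc n) l = ⊥-elim (ℕ.<⇒≱ l (ℕ.m≤m*n N (suc n)))

-- The bound is on the distance of the remainders so as to cover, besides two remainders below `N`,
-- the comparison in `interior` of the closed range from 0 to `N` with the open one.
same-quotient : ∀ N k k′ m n → + N ℤ.* k ℤ.+ + m ≡ + N ℤ.* k′ ℤ.+ + n → ∣ n ℤ.⊖ m ∣ ℕ.< N → k ≡ k′
same-quotient N k k′ m n e l = ℤ.i-j≡0⇒i≡j k k′ (small-multiple N (k ℤ.- k′) (subst (ℕ._< N) (cong ∣_∣ (sym difference)) l))
  where
  open ≡-Reasoning
  difference : + N ℤ.* (k ℤ.- k′) ≡ n ℤ.⊖ m
  difference = begin
    + N ℤ.* (k ℤ.- k′)                                  ≡⟨ distribute (+ N) k k′ (+ m) ⟩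
    (+ N ℤ.* k ℤ.+ + m) ℤ.- + N ℤ.* k′ ℤ.- + m          ≡⟨ cong (λ z → z ℤ.- + N ℤ.* k′ ℤ.- + m) e ⟩
    (+ N ℤ.* k′ ℤ.+ + n) ℤ.- + N ℤ.* k′ ℤ.- + m         ≡⟨ cancel (+ N ℤ.* k′) (+ n) (+ m) ⟩
    + n ℤ.- + m                                         ≡⟨ ℤ.m-n≡m⊖n n m ⟩
    n ℤ.⊖ m                                             ∎
    where
    distribute : ∀ N k k′ m → N ℤ.* (k ℤ.- k′) ≡ (N ℤ.* k ℤ.+ m) ℤ.- N ℤ.* k′ ℤ.- m
    distribute = solve-∀
    cancel : ∀ z n m → (z ℤ.+ n) ℤ.- z ℤ.- m ≡ n ℤ.- m
    cancel = solve-∀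

close-Below : ∀ {N m n} → m ℕ.< N → n ℕ.< N → ∣ n ℤ.⊖ m ∣ ℕ.< N
close-Below {N} {m} {n} l l′ = ℕ.≤-<-trans (ℤ.∣m⊝n∣≤m⊔n n m) (ℕ.⊔-lub l′ l)

close-Inside : ∀ {N m n} → m ℕ.≤ N → 0 ℕ.< n → n ℕ.< N → ∣ n ℤ.⊖ m ∣ ℕ.< N
close-Inside {N} {m} {suc n} l z l′ with ℕ.m≤n⇒m<n∨m≡n l
... | inj₁ l″ = close-Below l″ l′
... | inj₂ refl = subst (ℕ._< m) (sym (ℤ.∣⊖∣-≤ (ℕ.<⇒≤ l′))) (ℕ.∸-monoʳ-< {m} {suc n} {0} z (ℕ.<⇒≤ l′))

digit-unique : ∀ J J′ δ δ′ → Below² 3 δ → Below² 3 δ′ → 𝟛 ⊗ J ⊕ δ ≡ 𝟛 ⊗ J′ ⊕ δ′ → J ≡ J′ × δ ≡ δ′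
digit-unique J J′ δ δ′ ((m , refl , lm) , (n , refl , ln)) ((m′ , refl , lm′) , (n′ , refl , ln′)) e = J≡J′ , δ≡δ′
  where
  J≡J′ : J ≡ J′
  J≡J′ = cong₂ _,_ (same-quotient 3 _ _ m m′ (cong proj₁ e) (close-Below lm lm′))
                   (same-quotient 3 _ _ n n′ (cong proj₂ e) (close-Below ln ln′))
  δ≡δ′ : (+ m , + n) ≡ (+ m′ , + n′)
  δ≡δ′ = ⊕-cancelˡ (𝟛 ⊗ J) (trans e (cong (λ J → 𝟛 ⊗ J ⊕ (+ m′ , + n′)) (sym J≡J′)))

t-Below : ∀ j → Below² 3 (t j)
t-Below j = (_ , refl , proj₁ (bounded j)) , (_ , refl , proj₂ (bounded j))
  where
  bounded : ∀ j → proj₁ (lookup tvec j) ℕ.< 3 × proj₂ (lookup tvec j) ℕ.< 3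
  bounded = toWitness {a? = Fin.all? λ j → proj₁ (lookup tvec j) ℕ.<? 3 ×-dec proj₂ (lookup tvec j) ℕ.<? 3} _

t-unique : ∀ J J′ j j′ → 𝟛 ⊗ J ⊕ t j ≡ 𝟛 ⊗ J′ ⊕ t j′ → J ≡ J′ × t j ≡ t j′
t-unique J J′ j j′ = digit-unique J J′ (t j) (t j′) (t-Below j) (t-Below j′)

t-injective : ∀ j j′ → t j ≡ t j′ → j ≡ j′
t-injective = toWitness {a? = Fin.all? λ j → Fin.all? λ j′ → t j ≟ t j′ →-dec j Fin.≟ j′} _

centre≢t : ∀ j → 𝟏 ≢ t j
centre≢t = toWitness {a? = Fin.all? λ j → ¬? (𝟏 ≟ t j)} _

divide : ∀ p → Σ Pt λ J → Σ (Fin 3 × Fin 3) λ (m , n) → p ≡ 𝟛 ⊗ J ⊕ (+ toℕ m , + toℕ n)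
divide (u , v) = (proj₁ (div u) , proj₁ (div v)) , (proj₁ (proj₂ (div u)) , proj₁ (proj₂ (div v))) , cong₂ _,_ (proj₂ (proj₂ (div u))) (proj₂ (proj₂ (div v)))
  where
  div : ∀ z → Σ ℤ λ q → Σ (Fin 3) λ r → z ≡ + 3 ℤ.* q ℤ.+ + toℕ r
  div z = z ℤ./ℕ 3 , Fin.fromℕ< (ℤ.n%ℕd<d z 3) ,
    trans (ℤ.a≡a%ℕn+[a/ℕn]*n z 3) (trans (swap (+ (z ℤ.%ℕ 3)) (z ℤ./ℕ 3))
      (cong (λ r → + 3 ℤ.* (z ℤ./ℕ 3) ℤ.+ + r) (sym (Fin.toℕ-fromℕ< (ℤ.n%ℕd<d z 3)))))
    where
    swap : ∀ r q → r ℤ.+ q ℤ.* + 3 ≡ + 3 ℤ.* q ℤ.+ r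
    swap = solve-∀

-- Cells, boxes and vertices

Cell-Below : ∀ {m r} → Cell m r → Below² (3 ^ m) r
Cell-Below unit = (0 , refl , s≤s z≤n) , (0 , refl , s≤s z≤n)
Cell-Below (copy {m} {r} s j) = extend (proj₁ (Cell-Below s)) (proj₁ (t-Below j)) , extend (proj₂ (Cell-Below s)) (proj₂ (t-Below j))
  where
  extend : ∀ {u v} → Below (3 ^ m) u → Below 3 v → Below (3 ^ suc m) (u ℤ.+ side m ℤ.* v)
  extend (n , refl , l) (k , refl , s≤s k≤2) = n ℕ.+ 3 ^ m ℕ.* k ,
    cong (λ z → + n ℤ.+ z) (trans (cong (ℤ._* + k) (side≡ m)) (sym (ℤ.pos-* (3 ^ m) k))) ,
    ℕ.+-mono-<-≤ l (subst (3 ^ m ℕ.* k ℕ.≤_) (ℕ.*-comm (3 ^ m) 2) (ℕ.*-monoʳ-≤ (3 ^ m) k≤2))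

Cell-𝟎 : ∀ m → Cell m 𝟎
Cell-𝟎 m = subst (Cell m) (≡×≡⇒≡ (solve 1 (λ s → (s :- con 𝟏) :* con 𝟎 := con 𝟎) (refl , refl) (𝕤 m)))
  (corner-Cell m (half {𝟎} 0F refl))

-- A vertex strictly inside a box belongs to no other box.
interior : ∀ {x p} m K q → V x p → p ⊕ offset x m ≡ 𝕤 m ⊗ K ⊕ q → Inside² (3 ^ m) q → Fill x m K
interior {x} {p} m K q (corner o f y refl) e (in₁ , in₂) with ancestor f m
... | K′ , r , f′ , s , e′ = subst (Fill x m) (cong₂ _,_
      (coordinate (proj₁ (Cell-Below s)) (proj₁ (pos-≤1 y)) in₁ (cong proj₁ total))
      (coordinate (proj₂ (Cell-Below s)) (proj₂ (pos-≤1 y)) in₂ (cong proj₂ total))) f′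
  where
  pos-≤1 : ∀ y → Below² 2 (pos y)
  pos-≤1 a = (0 , refl , s≤s z≤n) , (0 , refl , s≤s z≤n)
  pos-≤1 b = (1 , refl , s≤s (s≤s z≤n)) , (0 , refl , s≤s z≤n)
  pos-≤1 c = (1 , refl , s≤s (s≤s z≤n)) , (1 , refl , s≤s (s≤s z≤n))
  pos-≤1 d = (0 , refl , s≤s z≤n) , (1 , refl , s≤s (s≤s z≤n))
  total : 𝕤 m ⊗ K′ ⊕ (r ⊕ pos y) ≡ 𝕤 m ⊗ K ⊕ q
  total = linear (sym e′) (linear e (≡×≡⇒≡ (solve 6 (λ o f k′ r y kq →
    k′ :+ (r :+ y) :+ (o :+ f) :+ kq := kq :+ (k′ :+ r) :+ (o :+ y :+ f)) (refl , refl) o (offset x m) (𝕤 m ⊗ K′) r (pos y) (𝕤 m ⊗ K ⊕ q))))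
  coordinate : ∀ {r ε q k k′} → Below (3 ^ m) r → Below 2 ε → Inside (3 ^ m) q →
    side m ℤ.* k′ ℤ.+ (r ℤ.+ ε) ≡ side m ℤ.* k ℤ.+ q → k′ ≡ k
  -- A corner exceeds its cell's coordinate by at most 1, so it may lie on the far side of its box:
  -- `r + ε` can equal `3 ^ m`.
  coordinate {k = k} {k′} (r , refl , lr) (ε , refl , s≤s lε) (q , refl , q>0 , lq) e =
    same-quotient (3 ^ m) k′ k (r ℕ.+ ε) q (subst (λ z → z ℤ.* k′ ℤ.+ + (r ℕ.+ ε) ≡ z ℤ.* k ℤ.+ + q) (side≡ m) e)
      (close-Inside (ℕ.≤-trans (ℕ.+-monoʳ-≤ r lε) (subst (ℕ._≤ 3 ^ m) (ℕ.+-comm 1 r) lr)) q>0 lq)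

-- The upper right corner of the lowest-left cell is strictly inside the box once `m ≥ 1`, so
-- together with `interior` it tests filling.
box-vertex : ∀ {x} m K → Fill x m K → V x (𝕤 m ⊗ K ⊕ 𝟏 ⊖ offset x m)
box-vertex {x} m K f = corner _ (subcell f (Cell-𝟎 m)) c
  (≡×≡⇒≡ (solve 2 (λ s o → s :+ con 𝟏 :- o := s :+ con 𝟎 :- o :+ con 𝟏) (refl , refl) (𝕤 m ⊗ K) (offset x m)))

-- The central box, in the level-m grid, of the root box of level suc m.
centre : Word → ℕ → Pt
centre x m = 𝟏 ⊖ t (x m)

centre-empty : ∀ x m → ¬ Fill x m (centre x m)
centre-empty x m f with parent f
... | J , j , e , _ = centre≢t j (proj₂ (digit-unique 𝟎 J 𝟏 (t j) ((1 , refl , s≤s (s≤s z≤n)) , (1 , refl , s≤s (s≤s z≤n))) (t-Below j)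
  (trans (sym (⊖-⊕ 𝟏 (t (x m)))) e)))

centre-neighbour : ∀ x m y → Fill x m (centre x m ⊕ dir y)
centre-neighbour x m y = there 𝟎 (proj₁ (neighbour y)) (linear (proj₂ (neighbour y)) (≡×≡⇒≡ (solve 3
  (λ t v u → con 𝟏 :- t :+ v :+ t :+ (con 𝟛 :* con 𝟎 :+ u) := con 𝟛 :* con 𝟎 :+ u :+ (con 𝟏 :+ v))
  (refl , refl) (t (x m)) (dir y) (t (proj₁ (neighbour y)))))) here
  where
  neighbour : ∀ y → Σ X λ j → 𝟏 ⊕ dir y ≡ 𝟛 ⊗ 𝟎 ⊕ t j
  neighbour = toWitness {a? = all-Y? λ y → Fin.any? λ j → _ ≟ _} _

-- An isomorphism respects the boxes of every level

record Maps (g : D4) (I : Pt) (x x′ : Word) : Set where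
  field
    forth : ∀ {p} → V x p → V x′ (T g (+ 1) p ⊕ I)
    back  : ∀ {p} → V x′ (T g (+ 1) p ⊕ I) → V x p

rigid-Maps : ∀ {x x′} → Correspondence x x′ → Σ D4 λ g → Σ Pt λ I → Maps g I x x′
rigid-Maps {x} {x′} C = g , I , record { forth = forth ; back = back }
  where
  open Correspondence C
  g = proj₁ (rigid C)
  I = proj₁ (proj₂ (rigid C))
  A : Pt → Pt
  A p = T g (+ 1) p ⊕ I
  R-A : ∀ {p} → V x p → R p (A p)
  R-A = proj₂ (proj₂ (rigid C))
  A-injective : ∀ p q → A p ≡ A q → p ≡ q
  A-injective p q e = trans (sym (T-invˡ g (+ 1) p)) (trans (cong (T (inv g) (+ 1)) (⊕-cancelʳ (T g (+ 1) p) (T g (+ 1) q) I e)) (T-invˡ g (+ 1) q))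
  -- `R` does not record that images are vertices; this follows because an edge at `p` goes to an
  -- edge.
  forth : ∀ {p} → V x p → V x′ (A p)
  forth v = E⇒V (edges (R-A v) (R-A (E⇒V (E-sym (proj₂ (V⇒E v))))) (proj₂ (V⇒E v)))
  back : ∀ {p} → V x′ (A p) → V x p
  back {p} v = subst (V x) (A-injective (proj₁ (onto v)) p (functional (R-A (proj₁ (proj₂ (onto v)))) (proj₂ (proj₂ (onto v)))))
    (proj₁ (proj₂ (onto v)))

record FillMaps (g : D4) (I : Pt) (x x′ : Word) (m : ℕ) : Set where
  field
    fill-forth : ∀ {K} → Fill x m K → Fill x′ m (T g (+ 0) K ⊕ I)
    fill-back  : ∀ {K} → Fill x′ m (T g (+ 0) K ⊕ I) → Fill x m K

-- An empty box with four filled neighbours is the centre of its parent, so the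
-- image of an empty centre is again a centre.
centre-to-centre : ∀ {g I x x′} m → FillMaps g I x x′ m →
  Σ Pt λ J → I ⊕ t (x′ m) ≡ 𝟛 ⊗ J ⊕ T g (+ 2) (t (x m))
centre-to-centre {g} {I} {x} {x′} m F = classify (divide (K′ ⊕ t (x′ m)))
  where
  open FillMaps F
  K = centre x m
  K′ = T g (+ 0) K ⊕ I

  neighbour : ∀ y → Fill x′ m (K′ ⊕ T g (+ 0) (dir y))
  neighbour y = subst (Fill x′ m) (trans (cong (_⊕ I) (T-translate g (+ 0) K (dir y)))
    (≡×≡⇒≡ (solve 3 (λ k u i → k :+ u :+ i := k :+ i :+ u) (refl , refl) (T g (+ 0) K) (T g (+ 0) (dir y)) I)))
    (fill-forth (centre-neighbour x m y))

  sibling : ∀ g j → Σ Y λ y → Σ X λ j′ → t j ⊕ T g (+ 0) (dir y) ≡ t j′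
  sibling = toWitness {a? = all-D4? λ g → Fin.all? λ j → any-Y? λ y → Fin.any? λ j′ → _ ≟ _} _

  impossible : ∀ J j → K′ ⊕ t (x′ m) ≡ 𝟛 ⊗ J ⊕ t j → ⊥
  -- From any outer position some direction leads to another outer position of the same parent. That
  -- neighbour is filled, so the parent `J` is, and then so is the supposedly empty box.
  impossible J j e = centre-empty x m (fill-back (there J j e (subst (Fill x′ (suc m)) J≡ (proj₂ (proj₂ (proj₂ up))))))
    where
    y = proj₁ (sibling g j)
    j′ = proj₁ (proj₂ (sibling g j))
    move : ∀ k u v J s w → k ⊕ v ≡ J ⊕ s → s ⊕ u ≡ w → k ⊕ u ⊕ v ≡ J ⊕ w
    move k u v J s w e refl = linear e (≡×≡⇒≡ (solve 5 (λ k u v J s →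
      k :+ u :+ v :+ (J :+ s) := J :+ (s :+ u) :+ (k :+ v)) (refl , refl) k u v J s))
    moved : K′ ⊕ T g (+ 0) (dir y) ⊕ t (x′ m) ≡ 𝟛 ⊗ J ⊕ t j′
    moved = move K′ (T g (+ 0) (dir y)) (t (x′ m)) (𝟛 ⊗ J) (t j) (t j′) e (proj₂ (proj₂ (sibling g j)))
    up = parent (neighbour y)
    J≡ : proj₁ up ≡ J
    J≡ = sym (proj₁ (t-unique J (proj₁ up) j′ (proj₁ (proj₂ up)) (trans (sym moved) (proj₁ (proj₂ (proj₂ up))))))

  centred : ∀ J → K′ ⊕ t (x′ m) ≡ 𝟛 ⊗ J ⊕ 𝟏 → I ⊕ t (x′ m) ≡ 𝟛 ⊗ J ⊕ T g (+ 2) (t (x m))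
  centred J e = solve-I (T g (+ 0) K) I (t (x′ m)) (𝟛 ⊗ J) (T g (+ 2) (t (x m))) e
    (trans (sym (T-+ g (+ 2) (+ 0) (t (x m)) K))
    (trans (cong (T g (+ 2)) (≡×≡⇒≡ (solve 1 (λ u → u :+ (con 𝟏 :- u) := con 𝟏) (refl , refl) (t (x m))))) (T-centre g)))
    where
    T-centre : ∀ g → T g (+ 2) 𝟏 ≡ 𝟏
    T-centre = toWitness {a? = all-D4? λ g → _ ≟ _} _
    solve-I : ∀ k i u J s → k ⊕ i ⊕ u ≡ J ⊕ 𝟏 → s ⊕ k ≡ 𝟏 → i ⊕ u ≡ J ⊕ s
    solve-I k i u J s e e′ = linear e (linear (sym e′) (≡×≡⇒≡ (solve 5 (λ k i u J s →
      i :+ u :+ (J :+ con 𝟏) :+ (s :+ k) := J :+ s :+ (k :+ i :+ u) :+ con 𝟏) (refl , refl) k i u J s)))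

  digit : ∀ m n → (+ toℕ m , + toℕ n) ≡ 𝟏 ⊎ Σ X λ j → (+ toℕ m , + toℕ n) ≡ t j
  digit = toWitness {a? = Fin.all? λ (m : Fin 3) → Fin.all? λ (n : Fin 3) →
    (+ toℕ m , + toℕ n) ≟ 𝟏 ⊎-dec Fin.any? λ j → (+ toℕ m , + toℕ n) ≟ t j} _

  classify : (Σ Pt λ J → Σ (Fin 3 × Fin 3) λ (m′ , n′) → K′ ⊕ t (x′ m) ≡ 𝟛 ⊗ J ⊕ (+ toℕ m′ , + toℕ n′)) →
    Σ Pt λ J → I ⊕ t (x′ m) ≡ 𝟛 ⊗ J ⊕ T g (+ 2) (t (x m))
  classify (J , (m′ , n′) , e) with digit m′ n′
  ... | inj₁ δ≡ = J , centred J (trans e (cong (𝟛 ⊗ J ⊕_) δ≡))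
  ... | inj₂ (j , δ≡) = ⊥-elim (impossible J j (trans e (cong (𝟛 ⊗ J ⊕_) δ≡)))

-- Level-1 boxes are full 4 × 4 grids of vertices, since the hole of side 1 has
-- its four corners in the graph.
grid : Fin 4 → Fin 4 → Pt
grid α β = (+ toℕ α , + toℕ β)

V⇒grid : ∀ {x p} → V x p → Σ Pt λ J → Σ (Fin 4) λ α → Σ (Fin 4) λ β → Fill x 1 J × p ⊕ t (x 0) ≡ 𝟛 ⊗ J ⊕ grid α β
V⇒grid {x} {p} (corner o f y e) = J , proj₁ (place j y) , proj₁ (proj₂ (place j y)) , proj₂ (proj₂ (proj₂ (parent f))) ,
  combine p o (pos y) (t (x 0)) (𝟛 ⊗ J) (t j) _ e (proj₁ (proj₂ (proj₂ (parent f)))) (proj₂ (proj₂ (place j y)))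
  where
  J = proj₁ (parent f)
  j = proj₁ (proj₂ (parent f))
  place : ∀ j y → Σ (Fin 4) λ α → Σ (Fin 4) λ β → t j ⊕ pos y ≡ grid α β
  place = toWitness {a? = Fin.all? λ j → all-Y? λ y → Fin.any? λ α → Fin.any? λ β → _ ≟ grid α β} _
  combine : ∀ p o y u J s γ → p ≡ o ⊕ y → o ⊕ u ≡ J ⊕ s → s ⊕ y ≡ γ → p ⊕ u ≡ J ⊕ γ
  combine p o y u J s γ refl e refl = linear e (≡×≡⇒≡ (solve 5 (λ o y u J s →
    o :+ y :+ u :+ (J :+ s) := J :+ (s :+ y) :+ (o :+ u)) (refl , refl) o y u J s))

grid⇒V : ∀ {x} J α β p → Fill x 1 J → p ⊕ t (x 0) ≡ 𝟛 ⊗ J ⊕ grid α β → V x p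
grid⇒V {x} J α β p f e = corner (𝟛 ⊗ J ⊕ t j ⊖ t (x 0)) (there J j (⊖-⊕ (𝟛 ⊗ J ⊕ t j) (t (x 0))) f) y
  (combine p (t (x 0)) (𝟛 ⊗ J) (grid α β) (t j) (pos y) e (proj₂ (proj₂ (place α β))))
  where
  place : ∀ α β → Σ X λ j → Σ Y λ y → grid α β ≡ t j ⊕ pos y
  place = toWitness {a? = Fin.all? λ α → Fin.all? λ β → Fin.any? λ j → any-Y? λ y → grid α β ≟ _} _
  j = proj₁ (place α β)
  y = proj₁ (proj₂ (place α β))
  combine : ∀ p u J γ s y → p ⊕ u ≡ J ⊕ γ → γ ≡ s ⊕ y → p ≡ J ⊕ s ⊖ u ⊕ y
  combine p u J γ s y e refl = linear e (≡×≡⇒≡ (solve 5 (λ p u J s y →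
    p :+ (J :+ (s :+ y)) := J :+ s :- u :+ y :+ (p :+ u)) (refl , refl) p u J s y))

step-in-grid : ∀ {x} J α β p i α′ β′ → Fill x 1 J → p ⊕ t (x 0) ≡ 𝟛 ⊗ J ⊕ grid α β →
  grid α β ⊕ dir i ≡ grid α′ β′ → V x (p ⊕ dir i)
step-in-grid {x} J α β p i α′ β′ f e e′ = grid⇒V J α′ β′ (p ⊕ dir i) f
  (combine p (dir i) (t (x 0)) (𝟛 ⊗ J) (grid α β) (grid α′ β′) e e′)
  where
  combine : ∀ p i u J γ γ′ → p ⊕ u ≡ J ⊕ γ → γ ⊕ i ≡ γ′ → p ⊕ i ⊕ u ≡ J ⊕ γ′
  combine p i u J γ γ′ e refl = linear e (≡×≡⇒≡ (solve 5 (λ p i u J γ →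
    p :+ i :+ u :+ (J :+ γ) := J :+ (γ :+ i) :+ (p :+ u)) (refl , refl) p i u J γ))

Multiple : ℤ → Set
Multiple z = Σ ℤ λ u → z ≡ + 3 ℤ.* u

multiple-+ : ∀ {z} w v k → z ≡ + 3 ℤ.* w ℤ.+ v → v ≡ + 3 ℤ.* k → Multiple z
multiple-+ w v k refl refl = w ℤ.+ k , sym (ℤ.*-distribˡ-+ (+ 3) w k)

-- A vertex with a missing horizontal (vertical) neighbour lies on a vertical
-- (horizontal) line of the grid of boxes of level 1.
aligned₁ : ∀ {x p} i → proj₂ (dir i) ≡ + 0 → V x p → ¬ V x (p ⊕ dir i) → Multiple (proj₁ (p ⊕ t (x 0)))
aligned₁ {x} {p} i h v ¬v = conclude (V⇒grid v)
  where
  -- A horizontal step leaves the grid only from column 0 or 3.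
  escape : ∀ i α β → proj₂ (dir i) ≡ + 0 →
    (Σ (Fin 4) λ α′ → grid α β ⊕ dir i ≡ grid α′ β) ⊎ (Σ (Fin 2) λ k → + toℕ α ≡ + 3 ℤ.* + toℕ k)
  escape = toWitness {a? = all-Y? λ i → Fin.all? λ α → Fin.all? λ β → proj₂ (dir i) ℤ.≟ + 0 →-dec
    (Fin.any? (λ α′ → grid α β ⊕ dir i ≟ grid α′ β) ⊎-dec Fin.any? λ k → + toℕ α ℤ.≟ + 3 ℤ.* + toℕ k)} _
  conclude : (Σ Pt λ J → Σ (Fin 4) λ α → Σ (Fin 4) λ β → Fill x 1 J × p ⊕ t (x 0) ≡ 𝟛 ⊗ J ⊕ grid α β) → Multiple (proj₁ (p ⊕ t (x 0)))
  conclude (J , α , β , f , e) with escape i α β h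
  ... | inj₁ (α′ , e′) = ⊥-elim (¬v (step-in-grid J α β p i α′ β f e e′))
  ... | inj₂ (k , e′) = multiple-+ (proj₁ J) (+ toℕ α) (+ toℕ k) (cong proj₁ e) e′

aligned₂ : ∀ {x p} i → proj₁ (dir i) ≡ + 0 → V x p → ¬ V x (p ⊕ dir i) → Multiple (proj₂ (p ⊕ t (x 0)))
aligned₂ {x} {p} i h v ¬v = conclude (V⇒grid v)
  where
  escape : ∀ i α β → proj₁ (dir i) ≡ + 0 →
    (Σ (Fin 4) λ β′ → grid α β ⊕ dir i ≡ grid α β′) ⊎ (Σ (Fin 2) λ k → + toℕ β ≡ + 3 ℤ.* + toℕ k)
  escape = toWitness {a? = all-Y? λ i → Fin.all? λ α → Fin.all? λ β → proj₁ (dir i) ℤ.≟ + 0 →-dec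
    (Fin.any? (λ β′ → grid α β ⊕ dir i ≟ grid α β′) ⊎-dec Fin.any? λ k → + toℕ β ℤ.≟ + 3 ℤ.* + toℕ k)} _
  conclude : (Σ Pt λ J → Σ (Fin 4) λ α → Σ (Fin 4) λ β → Fill x 1 J × p ⊕ t (x 0) ≡ 𝟛 ⊗ J ⊕ grid α β) → Multiple (proj₂ (p ⊕ t (x 0)))
  conclude (J , α , β , f , e) with escape i α β h
  ... | inj₁ (β′ , e′) = ⊥-elim (¬v (step-in-grid J α β p i α β′ f e e′))
  ... | inj₂ (k , e′) = multiple-+ (proj₂ J) (+ toℕ β) (+ toℕ k) (cong proj₂ e) e′

multiple-shift : ∀ {u z} v → u ≡ z ℤ.+ v → v ≡ + 0 → Multiple u → Multiple z
multiple-shift {z = z} v refl refl (k , e) = k , trans (sym (ℤ.+-identityʳ z)) e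

-- The images of the left and lower sides of the hole in the level-2 box of the
-- root are lines of the level-1 grid of Γ_x′.
align : ∀ {g I x x′} → Maps g I x x′ → Σ Pt λ J → I ⊕ t (x′ 0) ≡ 𝟛 ⊗ J ⊕ T g (+ 2) (t (x 0))
align {g} {I} {x} {x′} M = finish (axes g)
  where
  open Maps M
  K = centre x 1
  -- The lower-left corner of the hole of side 3, in unit-cell coordinates.
  h = 𝟛 ⊗ K ⊖ t (x 0)
  A : Pt → Pt
  A p = T g (+ 1) p ⊕ I

  A-⊕ : ∀ p u → A (p ⊕ u) ≡ A p ⊕ T g (+ 0) u
  A-⊕ = affine-⊕ g I

  hole : ∀ p → p ≡ h ⊕ 𝟏 → ¬ V x p
  hole p e v = centre-empty x 1 (interior 1 K 𝟏 v
    (trans (cong (_⊕ offset x 1) e) (≡×≡⇒≡ (solve 2 (λ k u → k :- u :+ con 𝟏 :+ (con 𝟎 :+ con (𝕤 0) :* u) := k :+ con 𝟏)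
      (refl , refl) (𝟛 ⊗ K) (t (x 0)))))
    ((1 , refl , s≤s z≤n , s≤s (s≤s z≤n)) , (1 , refl , s≤s z≤n , s≤s (s≤s z≤n))))

  rim : ∀ i α β → V x (𝟛 ⊗ (K ⊕ dir i) ⊕ grid α β ⊖ t (x 0))
  rim i α β = grid⇒V (K ⊕ dir i) α β _ (centre-neighbour x 1 i) (⊖-⊕ (𝟛 ⊗ (K ⊕ dir i) ⊕ grid α β) (t (x 0)))

  -- Two points on the rim, each one step from the missing point `h ⊕ 𝟏`; they belong to the filled
  -- boxes to the left of the hole and below it.
  left : V x (h ⊕ dir b)
  left = subst (V x) (≡×≡⇒≡ (solve 2 (λ k u → con 𝟛 :* (k :+ con (dir c)) :+ con (grid 3F 1F) :- u := con 𝟛 :* k :- u :+ con (dir b))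
    (refl , refl) K (t (x 0)))) (rim c 3F 1F)
  bottom : V x (h ⊕ dir a)
  bottom = subst (V x) (≡×≡⇒≡ (solve 2 (λ k u → con 𝟛 :* (k :+ con (dir d)) :+ con (grid 1F 3F) :- u := con 𝟛 :* k :- u :+ con (dir a))
    (refl , refl) K (t (x 0)))) (rim d 1F 3F)
  missing-left : ¬ V x (h ⊕ dir b ⊕ dir a)
  missing-left = hole _ (≡×≡⇒≡ (solve 1 (λ h → h :+ con (dir b) :+ con (dir a) := h :+ con 𝟏) (refl , refl) h))
  missing-bottom : ¬ V x (h ⊕ dir a ⊕ dir b)
  missing-bottom = hole _ (≡×≡⇒≡ (solve 1 (λ h → h :+ con (dir a) :+ con (dir b) := h :+ con 𝟏) (refl , refl) h))

  image : ∀ p i j → V x p → ¬ V x (p ⊕ dir i) → T g (+ 0) (dir i) ≡ dir j → V x′ (A p) × ¬ V x′ (A p ⊕ dir j)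
  image p i j v ¬v e = forth v , λ v′ → ¬v (back (subst (V x′) (trans (cong (A p ⊕_) (sym e)) (sym (A-⊕ p (dir i)))) v′))

  on-lines : Set
  on-lines = Multiple (proj₁ (A h ⊕ t (x′ 0))) × Multiple (proj₂ (A h ⊕ t (x′ 0)))

  along-side : ∀ u j → T g (+ 0) u ≡ dir j → A (h ⊕ u) ⊕ t (x′ 0) ≡ A h ⊕ t (x′ 0) ⊕ dir j
  along-side u j e = trans (cong (_⊕ t (x′ 0)) (trans (A-⊕ h u) (cong (A h ⊕_) e)))
    (≡×≡⇒≡ (solve 3 (λ p q r → p :+ q :+ r := p :+ r :+ q) (refl , refl) (A h) (dir j) (t (x′ 0))))

  axes : ∀ g → Σ Y λ i → Σ Y λ j → T g (+ 0) (dir a) ≡ dir i × T g (+ 0) (dir b) ≡ dir j ×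
    (proj₂ (dir i) ≡ + 0 × proj₁ (dir j) ≡ + 0 ⊎ proj₁ (dir i) ≡ + 0 × proj₂ (dir j) ≡ + 0)
  axes = toWitness {a? = all-D4? λ g → any-Y? λ i → any-Y? λ j →
    T g (+ 0) (dir a) ≟ dir i ×-dec (T g (+ 0) (dir b) ≟ dir j ×-dec
    ((proj₂ (dir i) ℤ.≟ + 0 ×-dec proj₁ (dir j) ℤ.≟ + 0) ⊎-dec (proj₁ (dir i) ℤ.≟ + 0 ×-dec proj₂ (dir j) ℤ.≟ + 0)))} _

  solve-I : ∀ J P k u i v → P ⊕ i ⊕ v ≡ 𝟛 ⊗ J → P ⊕ u ≡ 𝟛 ⊗ k → i ⊕ v ≡ 𝟛 ⊗ (J ⊖ k) ⊕ u
  solve-I J P k u i v e e′ = linear e (linear (sym e′) (≡×≡⇒≡ (solve 6 (λ J P k u i v →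
    i :+ v :+ con 𝟛 :* J :+ (P :+ u) := con 𝟛 :* (J :- k) :+ u :+ (P :+ i :+ v) :+ con 𝟛 :* k) (refl , refl) J P k u i v)))

  T-h : T g (+ 1) h ⊕ T g (+ 2) (t (x 0)) ≡ 𝟛 ⊗ T g (+ 1) K
  T-h = trans (sym (T-+ g (+ 1) (+ 2) h (t (x 0)))) (trans (cong (T g (+ 3)) (⊖-⊕ (𝟛 ⊗ K) (t (x 0)))) (T-* g (+ 3) (+ 1) K))

  conclude : on-lines → Σ Pt λ J → I ⊕ t (x′ 0) ≡ 𝟛 ⊗ J ⊕ T g (+ 2) (t (x 0))
  conclude ((u , e) , (v , e′)) = (u , v) ⊖ T g (+ 1) K ,
    solve-I (u , v) (T g (+ 1) h) (T g (+ 1) K) (T g (+ 2) (t (x 0))) I (t (x′ 0)) (cong₂ _,_ e e′) T-h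

  finish : (Σ Y λ i → Σ Y λ j → T g (+ 0) (dir a) ≡ dir i × T g (+ 0) (dir b) ≡ dir j ×
    (proj₂ (dir i) ≡ + 0 × proj₁ (dir j) ≡ + 0 ⊎ proj₁ (dir i) ≡ + 0 × proj₂ (dir j) ≡ + 0)) →
    Σ Pt λ J → I ⊕ t (x′ 0) ≡ 𝟛 ⊗ J ⊕ T g (+ 2) (t (x 0))
  finish (i , j , ei , ej , axis) = conclude (lines axis)
    where
    L = image (h ⊕ dir b) a i left missing-left ei
    B = image (h ⊕ dir a) b j bottom missing-bottom ej
    -- Each side settles the coordinate of `A h` that is constant along its image; a swap of axes
    -- exchanges the roles of the two sides.
    lines : proj₂ (dir i) ≡ + 0 × proj₁ (dir j) ≡ + 0 ⊎ proj₁ (dir i) ≡ + 0 × proj₂ (dir j) ≡ + 0 → on-lines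
    lines (inj₁ (i₂ , j₁)) =
      multiple-shift (proj₁ (dir j)) (cong proj₁ (along-side (dir b) j ej)) j₁ (aligned₁ i i₂ (proj₁ L) (proj₂ L)) ,
      multiple-shift (proj₂ (dir i)) (cong proj₂ (along-side (dir a) i ei)) i₂ (aligned₂ j j₁ (proj₁ B) (proj₂ B))
    lines (inj₂ (i₁ , j₂)) =
      multiple-shift (proj₁ (dir i)) (cong proj₁ (along-side (dir a) i ei)) i₁ (aligned₁ j j₂ (proj₁ B) (proj₂ B)) ,
      multiple-shift (proj₂ (dir j)) (cong proj₂ (along-side (dir b) j ej)) j₂ (aligned₂ i i₁ (proj₁ L) (proj₂ L))

Inside-flip : ∀ N f → 2 ℕ.≤ N → Inside N (flip f (+ N) (+ 1))
Inside-flip N false l = 1 , refl , s≤s z≤n , l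
Inside-flip (suc (suc n)) true (s≤s (s≤s z≤n)) = suc n , refl , s≤s z≤n , ℕ.≤-refl

Inside-T : ∀ N g → 2 ℕ.≤ N → Inside² N (T g (+ N) 𝟏)
Inside-T N (false , f₁ , f₂) l = Inside-flip N f₁ l , Inside-flip N f₂ l
Inside-T N (true , f₁ , f₂) l = Inside-flip N f₁ l , Inside-flip N f₂ l

2≤3^ : ∀ k → 2 ℕ.≤ 3 ^ suc k
2≤3^ k = ℕ.≤-trans (s≤s (s≤s z≤n)) (ℕ.m≤m*n 3 (3 ^ k) {{ℕ.m^n≢0 3 k}})

module Levels {g : D4} {I₀ : Pt} {x x′ : Word} (M : Maps g I₀ x x′) where
  open Maps M

  A : Pt → Pt
  A p = T g (+ 1) p ⊕ I₀

  -- A takes the level-m box of the root of Γ_x to the box I of the level-m grid of Γ_x′.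
  record Level (m : ℕ) (I : Pt) : Set where
    field at : ∀ p → A p ⊕ offset x′ m ≡ T g (side m) (p ⊕ offset x m) ⊕ 𝕤 m ⊗ I
  open Level

  level-zero : Level zero I₀
  level-zero .at p = trans (identity (T g (+ 1) p) I₀) (cong (λ p → T g (+ 1) p ⊕ 𝕤 0 ⊗ I₀) (sym (p⊕𝟎 p)))
    where
    identity : ∀ p i → p ⊕ i ⊕ 𝟎 ≡ p ⊕ 𝕤 0 ⊗ i
    identity p i = ≡×≡⇒≡ (solve 2 (λ p i → p :+ i :+ con 𝟎 := p :+ con (𝕤 0) :* i) (refl , refl) p i)
    p⊕𝟎 : ∀ p → p ⊕ 𝟎 ≡ p
    p⊕𝟎 p = ≡×≡⇒≡ (solve 1 (λ p → p :+ con 𝟎 := p) (refl , refl) p)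

  level-suc : ∀ m I J → Level m I → I ⊕ t (x′ m) ≡ 𝟛 ⊗ J ⊕ T g (+ 2) (t (x m)) → Level (suc m) J
  level-suc m I J L e .at p = combine (A p) (offset x′ m) (T g s (p ⊕ offset x m)) (𝕤 m) I (t (x′ m)) J (T g (+ 2) (t (x m))) _
      (at L p) e box
    where
    s = side m
    combine : ∀ A o′ B s I u′ J u B′ → A ⊕ o′ ≡ B ⊕ s ⊗ I → I ⊕ u′ ≡ 𝟛 ⊗ J ⊕ u → B′ ≡ B ⊕ s ⊗ u →
      A ⊕ (o′ ⊕ s ⊗ u′) ≡ B′ ⊕ 𝟛 ⊗ s ⊗ J
    combine A o′ B s I u′ J u B′ e e′ refl = linear e (linear (cong (s ⊗_) e′) (≡×≡⇒≡ (solve 8 (λ A o′ B s I u′ J u →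
      A :+ (o′ :+ s :* u′) :+ (B :+ s :* I) :+ s :* (con 𝟛 :* J :+ u)
      := B :+ s :* u :+ con 𝟛 :* s :* J :+ (A :+ o′) :+ s :* (I :+ u′)) (refl , refl) A o′ B s I u′ J u)))
    triple : ∀ s → + 3 ℤ.* s ≡ s ℤ.+ s ℤ.* + 2
    triple = solve-∀
    box : T g (+ 3 ℤ.* s) (p ⊕ (offset x m ⊕ 𝕤 m ⊗ t (x m))) ≡ T g s (p ⊕ offset x m) ⊕ 𝕤 m ⊗ T g (+ 2) (t (x m))
    box = begin
      T g (+ 3 ℤ.* s) (p ⊕ (offset x m ⊕ 𝕤 m ⊗ t (x m)))              ≡⟨ cong₂ (T g) (triple s) (≡×≡⇒≡ (solve 3 (λ p o u → p :+ (o :+ u) := p :+ o :+ u) (refl , refl) p (offset x m) (𝕤 m ⊗ t (x m)))) ⟩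
      T g (s ℤ.+ s ℤ.* + 2) (p ⊕ offset x m ⊕ 𝕤 m ⊗ t (x m))          ≡⟨ T-+ g s (s ℤ.* + 2) (p ⊕ offset x m) (𝕤 m ⊗ t (x m)) ⟩
      T g s (p ⊕ offset x m) ⊕ T g (s ℤ.* + 2) (𝕤 m ⊗ t (x m))        ≡⟨ cong (T g s (p ⊕ offset x m) ⊕_) (T-* g s (+ 2) (t (x m))) ⟩
      T g s (p ⊕ offset x m) ⊕ 𝕤 m ⊗ T g (+ 2) (t (x m))              ∎
      where open ≡-Reasoning

  -- Inner points witness filling both ways: `𝟏` goes to `T g s 𝟏`, and the `𝟏` of the image box
  -- comes from `T (inv g) s 𝟏`, each strictly inside.
  level-fill : ∀ k {I} → Level (suc k) I → FillMaps g I x x′ (suc k)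
  level-fill k {I} L = record { fill-forth = λ {K} → fill-forth K ; fill-back = λ {K} → fill-back K }
    where
    m = suc k
    s = side m
    image : ∀ K q → A (𝕤 m ⊗ K ⊕ q ⊖ offset x m) ⊕ offset x′ m ≡ 𝕤 m ⊗ (T g (+ 0) K ⊕ I) ⊕ T g s q
    image K q = trans (at L (𝕤 m ⊗ K ⊕ q ⊖ offset x m)) (trans (cong (_⊕ 𝕤 m ⊗ I) box)
      (≡×≡⇒≡ (solve 4 (λ q s k i → q :+ s :* k :+ s :* i := s :* (k :+ i) :+ q) (refl , refl) (T g s q) (𝕤 m) (T g (+ 0) K) I)))
      where
      box : T g s (𝕤 m ⊗ K ⊕ q ⊖ offset x m ⊕ offset x m) ≡ T g s q ⊕ 𝕤 m ⊗ T g (+ 0) K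
      box = trans (cong (T g s) (trans (⊖-⊕ (𝕤 m ⊗ K ⊕ q) (offset x m)) (≡×≡⇒≡ (solve 2 (λ p q → p :+ q := q :+ p) (refl , refl) (𝕤 m ⊗ K) q))))
        (trans (T-translate g s q (𝕤 m ⊗ K)) (cong (T g s q ⊕_) (T-scale g s K)))
    inside : ∀ g → Inside² (3 ^ m) (T g s 𝟏)
    inside g = subst (λ s → Inside² (3 ^ m) (T g s 𝟏)) (sym (side≡ m)) (Inside-T (3 ^ m) g (2≤3^ k))
    fill-forth : ∀ K → Fill x m K → Fill x′ m (T g (+ 0) K ⊕ I)
    fill-forth K f = interior m (T g (+ 0) K ⊕ I) (T g s 𝟏) (forth (box-vertex m K f)) (image K 𝟏) (inside g)
    fill-back : ∀ K → Fill x′ m (T g (+ 0) K ⊕ I) → Fill x m K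
    fill-back K f = interior m K q (back (subst (V x′) (sym place) (box-vertex m (T g (+ 0) K ⊕ I) f)))
      (⊖-⊕ (𝕤 m ⊗ K ⊕ q) (offset x m)) (inside (inv g))
      where
      q = T (inv g) s 𝟏
      place : A (𝕤 m ⊗ K ⊕ q ⊖ offset x m) ≡ 𝕤 m ⊗ (T g (+ 0) K ⊕ I) ⊕ 𝟏 ⊖ offset x′ m
      place = trans (sym (⊕-⊖ (A (𝕤 m ⊗ K ⊕ q ⊖ offset x m)) (offset x′ m)))
        (cong (_⊖ offset x′ m) (trans (image K q) (cong (𝕤 m ⊗ (T g (+ 0) K ⊕ I) ⊕_) (T-invʳ g s 𝟏))))

  -- Root boxes and their letters

  Next : ℕ → Pt → Pt → Set
  Next m I J = I ⊕ t (x′ m) ≡ 𝟛 ⊗ J ⊕ t (perm g (x m))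

  ascend : ∀ k I → Level (suc k) I → Σ Pt λ J → Next (suc k) I J × Level (suc (suc k)) J
  ascend k I L = extend (centre-to-centre (suc k) (level-fill k L))
    where
    extend : (Σ Pt λ J → I ⊕ t (x′ (suc k)) ≡ 𝟛 ⊗ J ⊕ T g (+ 2) (t (x (suc k)))) →
      Σ Pt λ J → Next (suc k) I J × Level (suc (suc k)) J
    extend (J , e) = J , trans e (cong (𝟛 ⊗ J ⊕_) (sym (t-perm g (x (suc k))))) , level-suc (suc k) I J L e

  Rooted : Set
  Rooted = Σ ℕ λ n → Level (suc n) 𝟎

  -- The recursion follows the ancestors of `I` in `Γ_x′`; by uniqueness of digits they are the
  -- images of the root's boxes of `Γ_x`.
  reach-root : ∀ k I → Fill x′ (suc k) I → Level (suc k) I → Rooted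
  reach-root k _ here L = k , L
  reach-root k I (there J j e f) L = continue (ascend k I L)
    where
    continue : (Σ Pt λ J → Next (suc k) I J × Level (suc (suc k)) J) → Rooted
    continue (J′ , e′ , L′) = reach-root (suc k) J f
      (subst (Level (suc (suc k))) (proj₁ (t-unique J′ J (perm g (x (suc k))) j (trans (sym e′) e))) L′)

  -- With both boxes at `𝟎`, uniqueness of quotient and digit gives the parent and the letter at
  -- once.
  stay : ∀ k → Level (suc k) 𝟎 → x′ (suc k) ≡ perm g (x (suc k)) × Level (suc (suc k)) 𝟎
  stay k L = continue (ascend k 𝟎 L)
    where
    continue : (Σ Pt λ J → Next (suc k) 𝟎 J × Level (suc (suc k)) J) → x′ (suc k) ≡ perm g (x (suc k)) × Level (suc (suc k)) 𝟎
    continue (J , e , L′) = t-injective _ _ (proj₂ unique) , subst (Level (suc (suc k))) (sym (proj₁ unique)) L′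
      where
      unique : 𝟎 ≡ J × t (x′ (suc k)) ≡ t (perm g (x (suc k)))
      unique = t-unique 𝟎 J (x′ (suc k)) (perm g (x (suc k))) e

  stay-rooted : ∀ n → Level (suc n) 𝟎 → ∀ k → Level (suc (k ℕ.+ n)) 𝟎
  stay-rooted n L zero = L
  stay-rooted n L (suc k) = proj₂ (stay (k ℕ.+ n) (stay-rooted n L k))

  rooted : ∀ I → Level 1 I → Rooted
  rooted I L = reach-root 0 I root-box L
    where
    root-box : Fill x′ 1 I
    root-box = subst (Fill x′ 1) (trans (cong (_⊕ I) (T-𝟎 g)) (𝟎⊕ I)) (FillMaps.fill-forth (level-fill 0 L) here)

  Rooted⇒Cofinal : Rooted → Cofinal x′ (perm g ∘ x)
  Rooted⇒Cofinal (n , L) = suc n , tail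
    where
    tail : ∀ i → suc n ℕ.≤ i → x′ i ≡ perm g (x i)
    tail (suc i) (s≤s n≤i) = subst (λ i → x′ (suc i) ≡ perm g (x (suc i))) (ℕ.m∸n+n≡m n≤i)
      (proj₁ (stay (i ℕ.∸ n ℕ.+ n) (stay-rooted n L (i ℕ.∸ n))))

  -- `level-fill` starts at level 1, so the equation for the step from level 0 is an argument,
  -- supplied by `align`.
  cofinal : (Σ Pt λ J → I₀ ⊕ t (x′ 0) ≡ 𝟛 ⊗ J ⊕ T g (+ 2) (t (x 0))) → Cofinal x′ (perm g ∘ x)
  cofinal (J , e) = Rooted⇒Cofinal (rooted J (level-suc 0 I₀ J level-zero e))

Maps⇒Cofinal : ∀ x x′ → (Σ D4 λ g → Σ Pt λ I → Maps g I x x′) → Σ (X → X) λ σ → InG σ × Cofinal x′ (σ ∘ x)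
Maps⇒Cofinal x x′ (g , I , M) = perm g , (word g , λ _ → refl) , Levels.cofinal M (align M)

mainTheorem2 : (y y' : Y) (x x' : Word) →
    GraphIso y x y' x' ⇔ (Σ (X → X) λ σ → InG σ × Cofinal x' (σ ∘ x))
mainTheorem2 y y' x x' = mk⇔
  (λ iso → Maps⇒Cofinal x x' (rigid-Maps (Iso⇒Correspondence {y} {x} {y'} {x'} iso)))
  λ (σ , σ∈G , tail) → Cofinal⇒Iso y y' x x' σ σ∈G tail
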